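{- Using the following procedure, all coefficients $a_{n,k}$ of the polynomials $P_n(y)$ for $1\le n\le N$ can be computed in $O(N^2)$ arithmetic operations on coefficients: compute $A_0=1$, $A_1=2$, $B_0=1$, $B_1=1$ and for $2\le n\le N$ $B_n=nB_{n-1}+n(n-1)A_{n-1}$, $A_n=n^2A_{n-1}+nB_{n-1}-(n-1)\sum_{k=1}^{n-1}\binom{n-2}{k-1}\{k(k-1)A_{k-1}-A_k+kB_{k-1}\}A_{n-k-1}$; set $a(0,0)=a(0,-1)=1$, $a(1,0)=1$, $a(1,1)=2$, other $a(0,k),a(1,k)=0$, and for $2\le n\le N$ set $a(n,n)=A_n$, $a(n,k)=0$ for $k<0$ or $k>n$, and $a(n,k)=na(n-1,k-1)+\frac{n(n-1)}{n-k}a(n-1,k)$ for $0\le k<n$; then $a(n,k)=a_{n,k}$.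
   Context: Define polynomials $P_n(y)$ by $P_0(y)=y-1$ and, for $n\ge1$, $P_n=nP_{n-1}-P'_{n-1}+\frac{1}{n}\sum_{k=1}^{n-1}k\{(k-1)P_{k-1}-P_k-P'_{k-1}\}P_{n-k-1}$ (equivalently, $1+\sum_{n\ge1}P_{n-1}(y)x^{ -n}$ is the unique formal solution of $V=1+\frac{y}{x}-\frac{1}{x}V-V_x-\frac{1}{x}V_y+\frac{1}{x}\log V$). For $n\ge1$ the coefficients $a_{n,k}$, $0\le k\le n$, are defined by $P_n(y)=\frac{(-1)^{n+1}}{n!}\sum_{k=0}^n(-1)^ka_{n,k}y^{n-k}$. -}

module Defs where

open import Data.Bool using (if_then_else_)
open import Data.Integer as ℤ using (ℤ; +_; -[1+_])
import Data.Integer.Properties as ℤ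
open import Data.List using (List; []; _∷_; _++_; map; replicate)
open import Data.Nat as ℕ using (ℕ; zero; suc; _∸_; _≤_; _<_; z≤n; s≤s; _!)
import Data.Nat.Properties as ℕ
open import Data.Product using (_×_; _,_)
open import Data.Rational as ℚ using (ℚ; 0ℚ; 1ℚ; NonZero)
open import Data.Sum using (inj₁; inj₂)
open import Relation.Binary.Definitions using (DecidableEquality)
open import Relation.Binary.PropositionalEquality using (_≡_; refl; trans; cong; cong₂)
open import Relation.Nullary using (does)
open import Relation.Nullary.Decidable using (dec-true; dec-false)

fromℕ : ℕ → ℚ
fromℕ n = + n ℚ./ 1

[-1]^_ : ℕ → ℚ
[-1]^ zero    = 1ℚ
[-1]^ (suc n) = ℚ.- ([-1]^ n)

1/_! : ℕ → ℚ
1/ n ! = ℚ._/_ (+ 1) (n !) {{n ℕ.!≢0}}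

update : ∀ {K X : Set} → DecidableEquality K → (K → X) → K → X → K → X
update _≟_ T k x l = if does (l ≟ k) then x else T l

infixl 9 _[_↦_] _[_↦_]ᶻ

_[_↦_] : ∀ {X : Set} → (ℕ → X) → ℕ → X → ℕ → X
_[_↦_] = update ℕ._≟_

_[_↦_]ᶻ : ∀ {X : Set} → (ℤ → X) → ℤ → X → ℤ → X
_[_↦_]ᶻ = update ℤ._≟_

------------------------------------------------------------------------
-- ℚ[y]: coefficient lists, constant term first, trailing zeros allowed.

Poly : Set
Poly = List ℚ

coeff : Poly → ℕ → ℚ
coeff []      _       = 0ℚ
coeff (c ∷ p) zero    = c
coeff (c ∷ p) (suc i) = coeff p i

infix 4 _≈ₚ_
_≈ₚ_ : Poly → Poly → Set
p ≈ₚ q = ∀ i → coeff p i ≡ coeff q i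

infixl 6 _+ₚ_ _-ₚ_
infixl 7 _*ₚ_
infixr 8 _·_
infix  9 _′

_+ₚ_ : Poly → Poly → Poly
[]      +ₚ q       = q
(c ∷ p) +ₚ []      = c ∷ p
(c ∷ p) +ₚ (d ∷ q) = (c ℚ.+ d) ∷ (p +ₚ q)

_·_ : ℚ → Poly → Poly
c · p = map (c ℚ.*_) p

_-ₚ_ : Poly → Poly → Poly
p -ₚ q = p +ₚ (ℚ.- 1ℚ) · q

_*ₚ_ : Poly → Poly → Poly
[]      *ₚ q = []
(c ∷ p) *ₚ q = c · q +ₚ (0ℚ ∷ (p *ₚ q))

-- (c + y p)′ = p + y p′
_′ : Poly → Poly
[] ′      = []
(c ∷ p) ′ = p +ₚ (0ℚ ∷ p ′)

y^_ : ℕ → Poly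
y^ m = replicate m 0ℚ ++ (1ℚ ∷ [])

-- ∑ n f = f 0 + ⋯ + f (n - 1)
∑ : ℕ → (ℕ → Poly) → Poly
∑ zero    f = []
∑ (suc n) f = ∑ n f +ₚ f n

-- The right-hand side of the recurrence for P n with n = m + 1; the
-- summation index is k = j + 1, so that n - k - 1 = m - (j + 1).
P-step : ℕ → (ℕ → Poly) → Poly
P-step m P =
  fromℕ (suc m) · P m -ₚ P m ′ +ₚ
  (+ 1 ℚ./ suc m) · ∑ m (λ j →
    fromℕ (suc j) · (fromℕ j · P j -ₚ P (suc j) -ₚ P j ′) *ₚ P (m ∸ suc j))

-- Course-of-values recursion: P-upTo n m is P m for m ≤ n.
P-upTo : ℕ → ℕ → Poly
P-upTo zero    = λ _ → ℚ.- 1ℚ ∷ 1ℚ ∷ []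
P-upTo (suc n) = P-upTo n [ suc n ↦ P-step n (P-upTo n) ]

P : ℕ → Poly
P n = P-upTo n n

private
  ∑-cong : ∀ n {f g : ℕ → Poly} → (∀ j → j < n → f j ≡ g j) → ∑ n f ≡ ∑ n g
  ∑-cong zero    h = refl
  ∑-cong (suc n) h =
    cong₂ _+ₚ_ (∑-cong n (λ j j<n → h j (ℕ.m<n⇒m<1+n j<n))) (h n ℕ.≤-refl)

  P-step-cong : ∀ m {F G : ℕ → Poly} → (∀ i → i ≤ m → F i ≡ G i) → P-step m F ≡ P-step m G
  P-step-cong m h = cong₂ _+ₚ_
    (cong (λ p → fromℕ (suc m) · p -ₚ p ′) (h m ℕ.≤-refl))
    (cong ((+ 1 ℚ./ suc m) ·_) (∑-cong m λ j j<m → cong₂ _*ₚ_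
      (cong₂ (λ p q → fromℕ (suc j) · (fromℕ j · p -ₚ q -ₚ p ′)) (h j (ℕ.<⇒≤ j<m)) (h (suc j) j<m))
      (h (m ∸ suc j) (ℕ.m∸n≤m m (suc j)))))

  P-upTo-suc : ∀ n → P-upTo (suc n) (suc n) ≡ P-step n (P-upTo n)
  P-upTo-suc n = cong (if_then P-step n (P-upTo n) else P-upTo n (suc n))
    (dec-true (suc n ℕ.≟ suc n) refl)

  P-upTo-≤ : ∀ n m → m ≤ n → P-upTo n m ≡ P m
  P-upTo-≤ zero    zero z≤n = refl
  P-upTo-≤ (suc n) m m≤1+n with ℕ.m≤n⇒m<n∨m≡n m≤1+n
  ... | inj₂ refl = refl
  ... | inj₁ (s≤s m≤n) = trans
    (cong (if_then P-step n (P-upTo n) else P-upTo n m)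
      (dec-false (m ℕ.≟ suc n) (ℕ.<⇒≢ (s≤s m≤n))))
    (P-upTo-≤ n m m≤n)

P-suc : ∀ m → P (suc m) ≡ P-step m P
P-suc m = trans (P-upTo-suc m) (P-step-cong m (P-upTo-≤ m))

expansion : ℕ → (ℕ → ℚ) → Poly
expansion n c =
  ([-1]^ (suc n) ℚ.* 1/ n !) · ∑ (suc n) (λ k → ([-1]^ k ℚ.* c k) · y^ (n ∸ k))

-- The number a_{n,k}, obtained by solving P n ≈ₚ expansion n (a[ n ,_]) for
-- the coefficient of y^(n-k).  That this identity holds, i.e. that
-- P n has degree at most n for n ≥ 1, is part of the theorem.
a[_,_] : ℕ → ℕ → ℚ
a[ n , k ] = [-1]^ (suc n) ℚ.* fromℕ (n !) ℚ.* [-1]^ k ℚ.* coeff (P n) (n ∸ k)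

------------------------------------------------------------------------
-- Programs over a type R of coefficients.  A program that is polymorphic in
-- R can produce new coefficients only through `calc`, whose cost is the
-- number of arithmetic operations in the expression.

infixl 6 _⊕_ _⊖_
infixl 7 _⊗_ _⊘_

data Expr (R : Set) : Set where
  ⌜_⌝             : R → Expr R
  _⊕_ _⊖_ _⊗_ _⊘_ : Expr R → Expr R → Expr R

operations : ∀ {R} → Expr R → ℕ
operations ⌜ _ ⌝   = 0
operations (e ⊕ f) = suc (operations e ℕ.+ operations f)
operations (e ⊖ f) = suc (operations e ℕ.+ operations f)
operations (e ⊗ f) = suc (operations e ℕ.+ operations f)
operations (e ⊘ f) = suc (operations e ℕ.+ operations f)

data Prog (R X : Set) : Set where
  return    : X → Prog R X
  calc-then : Expr R → (R → Prog R X) → Prog R X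

calc : ∀ {R} → Expr R → Prog R R
calc e = calc-then e return

infixl 1 _>>=_
_>>=_ : ∀ {R X Y} → Prog R X → (X → Prog R Y) → Prog R Y
return x      >>= f = f x
calc-then e κ >>= f = calc-then e (λ v → κ v >>= f)

-- for m s f runs f 0, …, f (m - 1) in this order, threading the state.
for : ∀ {R S} → ℕ → S → (ℕ → S → Prog R S) → Prog R S
for zero    s f = return s
for (suc m) s f = for m s f >>= f m

-- Division by zero has no value, so a program attempting it does not run.
infix 4 _⇓_
data _⇓_ : Expr ℚ → ℚ → Set where
  val : ∀ {x} → ⌜ x ⌝ ⇓ x
  add : ∀ {e f x y} → e ⇓ x → f ⇓ y → e ⊕ f ⇓ x ℚ.+ y
  sub : ∀ {e f x y} → e ⇓ x → f ⇓ y → e ⊖ f ⇓ x ℚ.- y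
  mul : ∀ {e f x y} → e ⇓ x → f ⇓ y → e ⊗ f ⇓ x ℚ.* y
  div : ∀ {e f x y} .{{_ : NonZero y}} → e ⇓ x → f ⇓ y → e ⊘ f ⇓ x ℚ.÷ y

-- Runs p x t: p terminates with result x after t arithmetic operations.
data Runs {X : Set} : Prog ℚ X → X → ℕ → Set where
  done : ∀ {x} → Runs (return x) x 0
  step : ∀ {e κ v x t} → e ⇓ v → Runs (κ v) x t →
         Runs (calc-then e κ) x (operations e ℕ.+ t)

-- The only coefficients available for free are 0 and 1.
module Procedure {R : Set} (0# 1# : R) where

  -- ι n is the index n as a coefficient, also obtained by counted additions.
  integers : ℕ → Prog R (ℕ → R)
  integers N = for N (λ _ → 0#) λ i ι → do
    v ← calc (⌜ ι i ⌝ ⊕ ⌜ 1# ⌝)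
    return (ι [ suc i ↦ v ])

  -- Row m holds C(m,0), …, C(m,m), by Pascal's rule, so that computing the
  -- binomial coefficients is counted too.
  binomials : ℕ → Prog R (ℕ → ℕ → R)
  binomials N = for N ((λ _ _ → 0#) [ 0 ↦ (λ _ → 0#) [ 0 ↦ 1# ] ]) λ m C → do
    row ← for (suc m) ((λ _ → 0#) [ 0 ↦ 1# ]) λ k row → do
      v ← calc (⌜ C m k ⌝ ⊕ ⌜ C m (suc k) ⌝)
      return (row [ suc k ↦ v ])
    return (C [ suc m ↦ row ])

  sequences : ℕ → (ι : ℕ → R) (C : ℕ → ℕ → R) (2# : R) → Prog R ((ℕ → R) × (ℕ → R))
  sequences N ι C 2# =
    for (N ∸ 1) ((λ _ → 0#) [ 0 ↦ 1# ] [ 1 ↦ 2# ] , (λ _ → 0#) [ 0 ↦ 1# ] [ 1 ↦ 1# ])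
      λ i (A , B) → let n = 2 ℕ.+ i in do
        b ← calc (⌜ ι n ⌝ ⊗ ⌜ B (n ∸ 1) ⌝ ⊕ ⌜ ι n ⌝ ⊗ ⌜ ι (n ∸ 1) ⌝ ⊗ ⌜ A (n ∸ 1) ⌝)
        s ← for (n ∸ 1) 0# λ j s → let k = suc j in
          calc (⌜ s ⌝ ⊕ ⌜ C (n ∸ 2) (k ∸ 1) ⌝
            ⊗ (⌜ ι k ⌝ ⊗ ⌜ ι (k ∸ 1) ⌝ ⊗ ⌜ A (k ∸ 1) ⌝ ⊖ ⌜ A k ⌝ ⊕ ⌜ ι k ⌝ ⊗ ⌜ B (k ∸ 1) ⌝)
            ⊗ ⌜ A (n ∸ k ∸ 1) ⌝)
        a ← calc (⌜ ι n ⌝ ⊗ ⌜ ι n ⌝ ⊗ ⌜ A (n ∸ 1) ⌝ ⊕ ⌜ ι n ⌝ ⊗ ⌜ B (n ∸ 1) ⌝ ⊖ ⌜ ι (n ∸ 1) ⌝ ⊗ ⌜ s ⌝)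
        return (A [ n ↦ a ] , B [ n ↦ b ])

  -- Entries never written are 0, as required for k < 0 and k > n.
  triangle : ℕ → (ι : ℕ → R) (2# : R) (A : ℕ → R) → Prog R (ℕ → ℤ → R)
  triangle N ι 2# A =
    for (N ∸ 1) ((λ _ _ → 0#) [ 0 ↦ (λ _ → 0#) [ + 0 ↦ 1# ]ᶻ [ -[1+ 0 ] ↦ 1# ]ᶻ ]
                              [ 1 ↦ (λ _ → 0#) [ + 0 ↦ 1# ]ᶻ [ + 1 ↦ 2# ]ᶻ ])
      λ i a → let n = 2 ℕ.+ i in do
        row ← for n ((λ _ → 0#) [ + n ↦ A n ]ᶻ) λ k row → do
          v ← calc (⌜ ι n ⌝ ⊗ ⌜ a (n ∸ 1) (+ k ℤ.- + 1) ⌝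
                ⊕ ⌜ ι n ⌝ ⊗ ⌜ ι (n ∸ 1) ⌝ ⊘ ⌜ ι (n ∸ k) ⌝ ⊗ ⌜ a (n ∸ 1) (+ k) ⌝)
          return (row [ + k ↦ v ]ᶻ)
        return (a [ n ↦ row ])

  procedure : ℕ → Prog R (ℕ → ℤ → R)
  procedure N = do
    2#      ← calc (⌜ 1# ⌝ ⊕ ⌜ 1# ⌝)
    ι       ← integers N
    C       ← binomials N
    (A , B) ← sequences N ι C 2#
    triangle N ι 2# A

open Procedure public using (procedure)

{-# OPTIONS --safe #-}

-- With t = 1/x let V = 1 + Σ P_n t^(n+1), U = log V and θ = t d/dt.  The
-- recurrence for P says θV = V θU, hence also V_y = V U_y.  Put
-- H = U_y + t (θU - U_y - 1).  Then V H = W, where the coefficient of t^(n+2)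
-- in W is w_n = P_{n+1}′ - P_n′ + n P_n and the lower ones vanish, while the
-- coefficient of t^(n+1) in H is w_n - n w_{n-1} + w_{n-1}′.  So W has order
-- one more than H unless it vanishes, but the same order as H since V has
-- constant term 1.  Hence all w_n vanish: P_{n+1}′ = P_n′ - n P_n.  Read off
-- coefficientwise, this gives the degree bound, the recurrence for the
-- triangle and the one for B_n = n! P_n′(0); the recurrence for
-- A_n = - n! P_n(0) is the defining recurrence of P at y = 0.
module Submission where

-- The definition of P is quadratic and involves all earlier terms, whereas the relation sought is
-- linear between neighbours; generating functions bridge the two. No logarithm is constructed: the
-- equation for V, solved for log V, gives a linear differential expression in V, and this
-- expression is taken as U. The equation V_y = V U_y then holds because both sides solve one
-- first-order linear equation in θ with the same constant term. The series H is not arbitrary. The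
-- relation sought says V_y + t (θV - V_y - V) = 0; W is the left side, and dividing it by V leaves
-- an expression in U alone. Since U is in turn linear in V, H can be computed a second time, now
-- from the w_n, and the two computations are played off against each other. The operation count
-- reflects what differentiation forgets. The linear relation yields each entry of row n with k < n
-- in a constant number of operations, but says nothing about P_n(0). The entry a_{n,n} therefore
-- needs the quadratic recurrence, at O(n) operations for each n.

open import Defs
open import Algebra using (CommutativeRing)
import Algebra.Properties.CommutativeMonoid.Mult as Mult
import Algebra.Properties.Semiring.Mult as SemiringMult
import Algebra.Solver.Ring.NaturalCoefficients.Default as NaturalSolver
open import Data.Bool using (if_then_else_)
open import Data.Integer as ℤ using (ℤ; -[1+_])
import Data.Integer.Properties as ℤ
open import Data.List using ([]; _∷_)
open import Data.Nat as ℕ using (ℕ; zero; suc; _∸_; _≤_; _<_; z≤n; s≤s; _!; _^_)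
open import Data.Nat.Combinatorics using (_C_; k>n⇒nCk≡0; nCk+nC[k+1]≡[n+1]C[k+1]; nCk≡n!/k![n-k]!; k![n∸k]!∣n!)
import Data.Nat.DivMod as ℕ
open import Data.Nat.Induction using (<-rec)
import Data.Nat.Properties as ℕ
open import Data.Nat.Solver using () renaming (module +-*-Solver to ℕ-Solver)
open import Data.Product using (∃-syntax; _,_; proj₁; proj₂)
open import Data.Rational as ℚ using (ℚ; 0ℚ; 1ℚ)
import Data.Rational.Properties as ℚ
open import Data.Rational.Solver using () renaming (module +-*-Solver to ℚ-Solver)
import Data.Rational.Unnormalised as ℚᵘ
import Data.Rational.Unnormalised.Properties as ℚᵘ
open import Data.Sum using (inj₁; inj₂)
open import Level using (_⊔_)
open import Relation.Binary.Definitions using (DecidableEquality)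
open import Relation.Binary.PropositionalEquality as ≡ using (_≡_; _≢_)
import Relation.Binary.Reasoning.Setoid as SetoidReasoning
open import Relation.Nullary using (yes; no; contradiction)
open import Relation.Nullary.Decidable using (dec-true; dec-false)

-- The summands are the costs of 2#, integers, binomials, sequences and triangle.
cost : ℕ → ℕ
cost N = 1 ℕ.+ (N ℕ.* 1 ℕ.+ (N ℕ.* (N ℕ.* 1) ℕ.+
  ((N ∸ 1) ℕ.* (4 ℕ.+ (N ℕ.* 8 ℕ.+ 6)) ℕ.+ (N ∸ 1) ℕ.* (N ℕ.* 5))))

-- In `m = N - 1` the cost is `14 m² + 26 m + 3`, with no coefficient above 26. The polynomial added
-- is the gap to `26 (m + 1)²`, which reduces the inequality to a ring identity.
cost-bound : ∀ N → 1 ≤ N → cost N ≤ 26 ℕ.* N ^ 2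
cost-bound N@(suc m) _ = ≡.subst (cost N ≤_) (≡.sym bound≡) (ℕ.m≤m+n (cost N) (12 ℕ.* m ℕ.* m ℕ.+ 26 ℕ.* m ℕ.+ 23))
  where
  bound≡ : 26 ℕ.* N ^ 2 ≡ cost N ℕ.+ (12 ℕ.* m ℕ.* m ℕ.+ 26 ℕ.* m ℕ.+ 23)
  bound≡ = solve 1 (λ m → con 26 :* (con 1 :+ m) :^ 2 :=
    con 1 :+ ((con 1 :+ m) :* con 1 :+ ((con 1 :+ m) :* ((con 1 :+ m) :* con 1) :+
      (m :* (con 4 :+ ((con 1 :+ m) :* con 8 :+ con 6)) :+ m :* ((con 1 :+ m) :* con 5))))
    :+ (con 12 :* m :* m :+ con 26 :* m :+ con 23)) ≡.refl m
    where open ℕ-Solver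

-- Derivations and formal power series

record Derivation {c ℓ} (R : CommutativeRing c ℓ) : Set (c ⊔ ℓ) where
  open CommutativeRing R
  field
    d       : Carrier → Carrier
    d-cong  : ∀ {x y} → x ≈ y → d x ≈ d y
    d-+     : ∀ x y → d (x + y) ≈ d x + d y
    leibniz : ∀ x y → d (x * y) ≈ d x * y + x * d y

  open SemiringMult semiring using (_×_)
  open SetoidReasoning setoid
  open import Algebra.Properties.AbelianGroup +-abelianGroup using (identityʳ-unique)

  d-0 : d 0# ≈ 0#
  d-0 = identityʳ-unique (d 0#) (d 0#) (trans (sym (d-+ 0# 0#)) (d-cong (+-identityˡ 0#)))

  d-1 : d 1# ≈ 0#
  d-1 = identityʳ-unique (d 1#) (d 1#) (sym (begin
    d 1#                     ≈⟨ d-cong (*-identityˡ 1#) ⟨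
    d (1# * 1#)              ≈⟨ leibniz 1# 1# ⟩
    d 1# * 1# + 1# * d 1#    ≈⟨ +-cong (*-identityʳ _) (*-identityˡ _) ⟩
    d 1# + d 1#              ∎))

  d-× : ∀ n x → d (n × x) ≈ n × d x
  d-× zero    x = d-0
  d-× (suc n) x = trans (d-+ x (n × x)) (+-congˡ (d-× n x))

-- Generic in the coefficients because it is applied twice, to form ℚ[[y]] and then ℚ[[y]][[t]].
module PowerSeries {c ℓ} (R : CommutativeRing c ℓ) where
  open CommutativeRing R
  open SemiringMult semiring using (_×_; ×-congʳ; ×-comm-*)
  open Mult +-commutativeMonoid using (×-distrib-+)
  open NaturalSolver commutativeSemiring using (solve; _:=_; _:+_; _:*_)
  open SetoidReasoning setoid

  Series : Set c
  Series = ℕ → Carrier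

  infix 4 _≋_
  _≋_ : Series → Series → Set ℓ
  a ≋ b = ∀ n → a n ≈ b n

  tail : Series → Series
  tail a n = a (suc n)

  shift : Series → Series
  shift a zero    = 0#
  shift a (suc n) = a n

  θ : Series → Series
  θ a n = n × a n

  infixl 6 _⊞_
  infixl 7 _⊛_

  _⊞_ : Series → Series → Series
  (a ⊞ b) n = a n + b n

  -- The recursion a b = a₀ b + t (tail a) b, rather than the convolution sum,
  -- lets every ring law be proved by induction on the exponent.
  _⊛_ : Series → Series → Series
  (a ⊛ b) zero    = a 0 * b 0
  (a ⊛ b) (suc n) = a 0 * b (suc n) + (tail a ⊛ b) n

  𝟘 𝟙 : Series
  𝟘 _       = 0#
  𝟙 zero    = 1#
  𝟙 (suc n) = 0#

  ⊛-cong : ∀ {a a′ b b′} → a ≋ a′ → b ≋ b′ → a ⊛ b ≋ a′ ⊛ b′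
  ⊛-cong a≋ b≋ zero    = *-cong (a≋ 0) (b≋ 0)
  ⊛-cong a≋ b≋ (suc n) = +-cong (*-cong (a≋ 0) (b≋ (suc n))) (⊛-cong (λ m → a≋ (suc m)) b≋ n)

  ⊛-zeroˡ : ∀ b → 𝟘 ⊛ b ≋ 𝟘
  ⊛-zeroˡ b zero    = zeroˡ (b 0)
  ⊛-zeroˡ b (suc n) = trans (+-cong (zeroˡ _) (⊛-zeroˡ b n)) (+-identityˡ 0#)

  ⊛-identityˡ : ∀ b → 𝟙 ⊛ b ≋ b
  ⊛-identityˡ b zero    = *-identityˡ (b 0)
  ⊛-identityˡ b (suc n) = trans (+-cong (*-identityˡ _) (⊛-zeroˡ b n)) (+-identityʳ _)

  ⊛-distribʳ : ∀ c a b → (a ⊞ b) ⊛ c ≋ a ⊛ c ⊞ b ⊛ c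
  ⊛-distribʳ c a b zero    = distribʳ (c 0) (a 0) (b 0)
  ⊛-distribʳ c a b (suc n) = trans (+-congˡ (⊛-distribʳ c (tail a) (tail b) n))
    (solve 5 (λ a b c x y → (a :+ b) :* c :+ (x :+ y) := a :* c :+ x :+ (b :* c :+ y)) refl
      (a 0) (b 0) (c (suc n)) _ _)

  ⊛-scaleˡ : ∀ x a b n → ((λ m → x * a m) ⊛ b) n ≈ x * (a ⊛ b) n
  ⊛-scaleˡ x a b zero    = *-assoc x (a 0) (b 0)
  ⊛-scaleˡ x a b (suc n) = trans (+-cong (*-assoc x (a 0) _) (⊛-scaleˡ x (tail a) b n)) (sym (distribˡ x _ _))

  -- Mirror image of the defining recursion, splitting the right factor instead of the left;
  -- commutativity is the comparison of the two.
  ⊛-suc : ∀ a b n → (a ⊛ b) (suc n) ≈ a (suc n) * b 0 + (a ⊛ tail b) n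
  ⊛-suc a b zero    = +-comm _ _
  ⊛-suc a b (suc n) = trans (+-congˡ (⊛-suc (tail a) b n))
    (solve 3 (λ x y z → x :+ (y :+ z) := y :+ (x :+ z)) refl _ _ _)

  ⊛-comm : ∀ a b → a ⊛ b ≋ b ⊛ a
  ⊛-comm a b zero    = *-comm (a 0) (b 0)
  ⊛-comm a b (suc n) = trans (+-cong (*-comm _ _) (⊛-comm (tail a) b n)) (sym (⊛-suc b a n))

  ⊛-assoc : ∀ a b c → (a ⊛ b) ⊛ c ≋ a ⊛ (b ⊛ c)
  ⊛-assoc a b c zero    = *-assoc (a 0) (b 0) (c 0)
  ⊛-assoc a b c (suc n) = begin
    a 0 * b 0 * c (suc n) + (tail (a ⊛ b) ⊛ c) n
      -- By definition `tail (a ⊛ b)` is the sum of `a 0` times `tail b` and `tail a ⊛ b`.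
      ≈⟨ +-congˡ (⊛-distribʳ c (λ m → a 0 * tail b m) (tail a ⊛ b) n) ⟩
    a 0 * b 0 * c (suc n) + (((λ m → a 0 * tail b m) ⊛ c) n + ((tail a ⊛ b) ⊛ c) n)
      ≈⟨ +-congˡ (+-cong (⊛-scaleˡ (a 0) (tail b) c n) (⊛-assoc (tail a) b c n)) ⟩
    a 0 * b 0 * c (suc n) + (a 0 * (tail b ⊛ c) n + (tail a ⊛ (b ⊛ c)) n)
      ≈⟨ solve 5 (λ a b c x y → a :* b :* c :+ (a :* x :+ y) := a :* (b :* c :+ x) :+ y) refl _ _ _ _ _ ⟩
    a 0 * (b ⊛ c) (suc n) + (tail a ⊛ (b ⊛ c)) n ∎

  ⊛-distribˡ : ∀ a b c → a ⊛ (b ⊞ c) ≋ a ⊛ b ⊞ a ⊛ c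
  ⊛-distribˡ a b c n = begin
    (a ⊛ (b ⊞ c)) n          ≈⟨ ⊛-comm a (b ⊞ c) n ⟩
    ((b ⊞ c) ⊛ a) n          ≈⟨ ⊛-distribʳ a b c n ⟩
    (b ⊛ a) n + (c ⊛ a) n    ≈⟨ +-cong (⊛-comm b a n) (⊛-comm c a n) ⟩
    (a ⊛ b) n + (a ⊛ c) n    ∎

  commutativeRing : CommutativeRing c ℓ
  commutativeRing = record
    { Carrier = Series
    ; _≈_ = _≋_
    ; _+_ = _⊞_
    ; _*_ = _⊛_
    ; -_  = λ a n → - a n
    ; 0#  = 𝟘
    ; 1#  = 𝟙
    ; isCommutativeRing = record
      { isRing = record
        { +-isAbelianGroup = record
          { isGroup = record
            { isMonoid = record
              { isSemigroup = record
                { isMagma = record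
                  { isEquivalence = record
                    { refl  = λ n → refl
                    ; sym   = λ p n → sym (p n)
                    ; trans = λ p q n → trans (p n) (q n)
                    }
                  ; ∙-cong = λ p q n → +-cong (p n) (q n)
                  }
                ; assoc = λ a b c n → +-assoc (a n) (b n) (c n)
                }
              ; identity = (λ a n → +-identityˡ (a n)) , (λ a n → +-identityʳ (a n))
              }
            ; inverse = (λ a n → -‿inverseˡ (a n)) , (λ a n → -‿inverseʳ (a n))
            ; ⁻¹-cong = λ p n → -‿cong (p n)
            }
          ; comm = λ a b n → +-comm (a n) (b n)
          }
        ; *-cong     = ⊛-cong
        ; *-assoc    = ⊛-assoc
        ; *-identity = ⊛-identityˡ , λ a n → trans (⊛-comm a 𝟙 n) (⊛-identityˡ a n)
        ; distrib    = ⊛-distribˡ , ⊛-distribʳ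
        }
      ; *-comm = ⊛-comm
      }
    }

  ⊛-shiftʳ : ∀ a b → a ⊛ shift b ≋ shift (a ⊛ b)
  ⊛-shiftʳ a b zero    = zeroʳ (a 0)
  ⊛-shiftʳ a b (suc n) = trans (⊛-suc a (shift b) n) (trans (+-congʳ (zeroʳ _)) (+-identityˡ _))

  ⊛-vanishesʳ : ∀ a b n → (∀ k → k ≤ n → b k ≈ 0#) → (a ⊛ b) n ≈ 0#
  ⊛-vanishesʳ a b zero    b≈0 = trans (*-congˡ (b≈0 0 z≤n)) (zeroʳ _)
  ⊛-vanishesʳ a b (suc n) b≈0 = trans
    (+-cong (trans (*-congˡ (b≈0 (suc n) ℕ.≤-refl)) (zeroʳ _))
            (⊛-vanishesʳ (tail a) b n (λ k k≤n → b≈0 k (ℕ.m≤n⇒m≤1+n k≤n))))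
    (+-identityˡ 0#)

  -- This is how orders of series are compared: a factor with constant term 1 changes neither the
  -- order nor the leading coefficient.
  ⊛-leading : ∀ a b n → (∀ k → k < n → b k ≈ 0#) → (a ⊛ b) n ≈ a 0 * b n
  ⊛-leading a b zero    b≈0 = refl
  ⊛-leading a b (suc n) b≈0 = trans
    (+-congˡ (⊛-vanishesʳ (tail a) b n (λ k k≤n → b≈0 k (s≤s k≤n)))) (+-identityʳ _)

  ⊛-cong-upTo : ∀ a b c n → (∀ k → k ≤ n → b k ≈ c k) → (a ⊛ b) n ≈ (a ⊛ c) n
  ⊛-cong-upTo a b c zero    b≈c = *-congˡ (b≈c 0 z≤n)
  ⊛-cong-upTo a b c (suc n) b≈c = +-cong (*-congˡ (b≈c (suc n) ℕ.≤-refl))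
    (⊛-cong-upTo (tail a) b c n (λ k k≤n → b≈c k (ℕ.m≤n⇒m≤1+n k≤n)))

  sum : ℕ → Series → Carrier
  sum zero    f = 0#
  sum (suc n) f = sum n f + f n

  sum-cong : ∀ n {f g} → (∀ j → j < n → f j ≈ g j) → sum n f ≈ sum n g
  sum-cong zero    f≈g = refl
  sum-cong (suc n) f≈g = +-cong (sum-cong n (λ j j<n → f≈g j (ℕ.m<n⇒m<1+n j<n))) (f≈g n ℕ.≤-refl)

  sum-suc : ∀ n f → sum (suc n) f ≈ f 0 + sum n (tail f)
  sum-suc zero    f = trans (+-identityˡ _) (sym (+-identityʳ _))
  sum-suc (suc n) f = trans (+-congʳ (sum-suc n f)) (+-assoc _ _ _)

  -- Link to the explicit sum in the recurrence for `P`.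
  ⊛-convolution : ∀ a b n → (a ⊛ b) n ≈ sum (suc n) (λ j → a j * b (n ∸ j))
  ⊛-convolution a b zero    = sym (+-identityˡ _)
  ⊛-convolution a b (suc n) = trans (+-congˡ (⊛-convolution (tail a) b n))
    (sym (sum-suc (suc n) (λ j → a j * b (suc n ∸ j))))

  θ-cong : ∀ {a b} → a ≋ b → θ a ≋ θ b
  θ-cong a≋b n = ×-congʳ n (a≋b n)

  θ-⊞ : ∀ a b → θ (a ⊞ b) ≋ θ a ⊞ θ b
  θ-⊞ a b n = ×-distrib-+ (a n) (b n) n

  -- The induction closes because `tail (θ a)` is `tail a ⊞ θ (tail a)`: the extra copy of
  -- `tail a ⊛ b` produced by `suc n = 1 + n` is the first summand times `b`.
  θ-leibniz : ∀ a b → θ (a ⊛ b) ≋ θ a ⊛ b ⊞ a ⊛ θ b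
  θ-leibniz a b zero    = sym (trans (+-cong (zeroˡ _) (zeroʳ _)) (+-identityˡ 0#))
  θ-leibniz a b (suc n) = begin
    suc n × (a 0 * b (suc n) + (tail a ⊛ b) n)
      ≈⟨ ×-distrib-+ _ _ (suc n) ⟩
    suc n × (a 0 * b (suc n)) + ((tail a ⊛ b) n + θ (tail a ⊛ b) n)
      ≈⟨ +-cong (sym (×-comm-* (suc n) _ _)) (+-congˡ (θ-leibniz (tail a) b n)) ⟩
    a 0 * θ b (suc n) + ((tail a ⊛ b) n + ((θ (tail a) ⊛ b) n + (tail a ⊛ θ b) n))
      ≈⟨ solve 4 (λ x y z w → x :+ (y :+ (z :+ w)) := y :+ z :+ (x :+ w)) refl _ _ _ _ ⟩
    (tail a ⊛ b) n + (θ (tail a) ⊛ b) n + (a ⊛ θ b) (suc n)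
      ≈⟨ +-congʳ (⊛-distribʳ b (tail a) (θ (tail a)) n) ⟨
    (tail (θ a) ⊛ b) n + (a ⊛ θ b) (suc n)
      ≈⟨ +-congʳ (trans (+-congʳ (zeroˡ _)) (+-identityˡ _)) ⟨
    (θ a ⊛ b) (suc n) + (a ⊛ θ b) (suc n) ∎

  -- Ordinary differentiation: `θ a` has constant term 0, so `tail` divides it by the variable.
  ∂ : Series → Series
  ∂ a = tail (θ a)

  ∂-derivation : Derivation commutativeRing
  ∂-derivation = record
    { d       = ∂
    ; d-cong  = λ a≋b n → θ-cong a≋b (suc n)
    ; d-+     = λ a b n → θ-⊞ a b (suc n)
    ; leibniz = λ a b n → trans (θ-leibniz a b (suc n)) (+-cong
        (trans (+-congʳ (zeroˡ _)) (+-identityˡ _))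
        (trans (⊛-suc a (θ b) n) (trans (+-congʳ (zeroʳ _)) (+-identityˡ _))))
    }

  module Lift (D : Derivation R) where
    open Derivation D

    d̂ : Series → Series
    d̂ a n = d (a n)

    d̂-leibniz : ∀ a b → d̂ (a ⊛ b) ≋ d̂ a ⊛ b ⊞ a ⊛ d̂ b
    d̂-leibniz a b zero    = leibniz (a 0) (b 0)
    d̂-leibniz a b (suc n) = trans (d-+ _ _) (trans
      (+-cong (leibniz (a 0) (b (suc n))) (d̂-leibniz (tail a) b n))
      (solve 4 (λ x y z w → x :+ y :+ (z :+ w) := x :+ z :+ (y :+ w)) refl _ _ _ _))

    d̂-θ : ∀ a → d̂ (θ a) ≋ θ (d̂ a)
    d̂-θ a n = d-× n (a n)

    module _ (×-cancel : ∀ n {x y} → suc n × x ≈ suc n × y → x ≈ y) where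

      -- As `g` has no constant term, coefficient `n + 1` of `g ⊛ a` involves only the coefficients
      -- of `a` up to `n`; cancelling `suc n` then determines the next one. The instance of interest
      -- is `g = θ u`, `f = v ⊛ θ (d̂ u)`, whose equation is solved both by `d̂ v` and by
      -- `v ⊛ d̂ u`.
      θ-unique : ∀ g f a b → g 0 ≈ 0# → a 0 ≈ b 0 →
                 θ a ≋ g ⊛ a ⊞ f → θ b ≋ g ⊛ b ⊞ f → a ≋ b
      θ-unique g f a b g₀≈0 a₀≈b₀ θa θb = <-rec _ go
        where
        coefficient : ∀ c n → (g ⊛ c) (suc n) ≈ (tail g ⊛ c) n
        coefficient c n = trans (+-congʳ (trans (*-congʳ g₀≈0) (zeroˡ _))) (+-identityˡ _)

        go : ∀ n → (∀ {k} → k < n → a k ≈ b k) → a n ≈ b n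
        go zero    _   = a₀≈b₀
        go (suc n) rec = ×-cancel n (begin
          suc n × a (suc n)                ≈⟨ θa (suc n) ⟩
          (g ⊛ a) (suc n) + f (suc n)      ≈⟨ +-congʳ (coefficient a n) ⟩
          (tail g ⊛ a) n + f (suc n)
            ≈⟨ +-congʳ (⊛-cong-upTo (tail g) a b n (λ k k≤n → rec (s≤s k≤n))) ⟩
          (tail g ⊛ b) n + f (suc n)       ≈⟨ +-congʳ (coefficient b n) ⟨
          (g ⊛ b) (suc n) + f (suc n)      ≈⟨ θb (suc n) ⟨
          suc n × b (suc n)                ∎)

      -- The hypothesis θ v ≋ v ⊛ θ u says that v is exp u up to a constant factor.
      logarithmic-derivative : ∀ v u → d (v 0) ≈ v 0 * d (u 0) → θ v ≋ v ⊛ θ u → d̂ v ≋ v ⊛ d̂ u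
      logarithmic-derivative v u eq₀ θv =
        θ-unique (θ u) (v ⊛ θ (d̂ u)) (d̂ v) (v ⊛ d̂ u) refl eq₀ left right
        where
        left : θ (d̂ v) ≋ θ u ⊛ d̂ v ⊞ v ⊛ θ (d̂ u)
        left n = begin
          θ (d̂ v) n                                    ≈⟨ d̂-θ v n ⟨
          d (θ v n)                                    ≈⟨ d-cong (θv n) ⟩
          d̂ (v ⊛ θ u) n                                ≈⟨ d̂-leibniz v (θ u) n ⟩
          (d̂ v ⊛ θ u) n + (v ⊛ d̂ (θ u)) n
            ≈⟨ +-cong (⊛-comm (d̂ v) (θ u) n) (⊛-cong {v} {v} (λ _ → refl) (d̂-θ u) n) ⟩
          (θ u ⊛ d̂ v) n + (v ⊛ θ (d̂ u)) n              ∎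

        right : θ (v ⊛ d̂ u) ≋ θ u ⊛ (v ⊛ d̂ u) ⊞ v ⊛ θ (d̂ u)
        right n = trans (θ-leibniz v (d̂ u) n) (+-congʳ (begin
          (θ v ⊛ d̂ u) n          ≈⟨ ⊛-cong {b = d̂ u} (λ m → trans (θv m) (⊛-comm v (θ u) m)) (λ _ → refl) n ⟩
          ((θ u ⊛ v) ⊛ d̂ u) n    ≈⟨ ⊛-assoc (θ u) v (d̂ u) n ⟩
          (θ u ⊛ (v ⊛ d̂ u)) n    ∎))

open import Data.Product using (_×_)
open import Data.Rational using (_+_; _*_; _-_; -_)
open ≡ using (refl; sym; trans; cong; cong₂; subst; module ≡-Reasoning)
open ℚ-Solver

-- The differential recurrence

module Qy = PowerSeries ℚ.+-*-commutativeRing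
module Qyt = PowerSeries Qy.commutativeRing
open Derivation Qy.∂-derivation using () renaming (d to ∂)
open Qyt.Lift Qy.∂-derivation using (d̂; logarithmic-derivative)
open SemiringMult (CommutativeRing.semiring ℚ.+-*-commutativeRing) using () renaming (_×_ to _×ℚ_)
open SemiringMult (CommutativeRing.semiring Qy.commutativeRing) using () renaming (_×_ to _×ˢ_)

-- Natural numbers as coefficients

-- `fromℕ` normalises by a gcd that is stuck on variables; among unnormalised fractions the claim is
-- a cross multiplication.
fromℕ-+ : ∀ m n → fromℕ (m ℕ.+ n) ≡ fromℕ m + fromℕ n
fromℕ-+ m n = ℚ.toℚᵘ-injective (begin
  ℚ.toℚᵘ (fromℕ (m ℕ.+ n))            ≈⟨ ℚ.toℚᵘ-fromℚᵘ (ℚᵘ.mkℚᵘ (ℤ.+ (m ℕ.+ n)) 0) ⟩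
  ℚᵘ.mkℚᵘ (ℤ.+ (m ℕ.+ n)) 0             ≈⟨ ℚᵘ.*≡* (cong (ℤ._* (ℤ.+ 1)) (sym (trans (cong₂ ℤ._+_ (ℤ.*-identityʳ (ℤ.+ m)) (ℤ.*-identityʳ (ℤ.+ n))) refl))) ⟩
  ℚᵘ.mkℚᵘ (ℤ.+ m) 0 ℚᵘ.+ ℚᵘ.mkℚᵘ (ℤ.+ n) 0
    ≈⟨ ℚᵘ.+-cong (ℚ.toℚᵘ-fromℚᵘ (ℚᵘ.mkℚᵘ (ℤ.+ m) 0)) (ℚ.toℚᵘ-fromℚᵘ (ℚᵘ.mkℚᵘ (ℤ.+ n) 0)) ⟨
  ℚ.toℚᵘ (fromℕ m) ℚᵘ.+ ℚ.toℚᵘ (fromℕ n)  ≈⟨ ℚ.toℚᵘ-homo-+ (fromℕ m) (fromℕ n) ⟨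
  ℚ.toℚᵘ (fromℕ m + fromℕ n)          ∎)
  where open ℚᵘ.≃-Reasoning

fromℕ-* : ∀ m n → fromℕ (m ℕ.* n) ≡ fromℕ m * fromℕ n
fromℕ-* zero    n = sym (ℚ.*-zeroˡ (fromℕ n))
fromℕ-* (suc m) n = begin
  fromℕ (n ℕ.+ m ℕ.* n)            ≡⟨ fromℕ-+ n (m ℕ.* n) ⟩
  fromℕ n + fromℕ (m ℕ.* n)        ≡⟨ cong (fromℕ n +_) (fromℕ-* m n) ⟩
  fromℕ n + fromℕ m * fromℕ n      ≡⟨ solve 2 (λ m n → n :+ m :* n := (con 1ℚ :+ m) :* n) refl (fromℕ m) (fromℕ n) ⟩
  (1ℚ + fromℕ m) * fromℕ n         ≡⟨ cong (_* fromℕ n) (fromℕ-+ 1 m) ⟨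
  fromℕ (suc m) * fromℕ n          ∎
  where open ≡-Reasoning

fromℕ-inverse : ∀ n .{{_ : ℕ.NonZero n}} → fromℕ n * (ℤ.+ 1 ℚ./ n) ≡ 1ℚ
fromℕ-inverse (suc n) = ℚ.toℚᵘ-injective (begin
  ℚ.toℚᵘ (fromℕ (suc n) * (ℤ.+ 1 ℚ./ suc n))  ≈⟨ ℚ.toℚᵘ-homo-* (fromℕ (suc n)) (ℤ.+ 1 ℚ./ suc n) ⟩
  ℚ.toℚᵘ (fromℕ (suc n)) ℚᵘ.* ℚ.toℚᵘ (ℤ.+ 1 ℚ./ suc n)
    ≈⟨ ℚᵘ.*-cong (ℚ.toℚᵘ-fromℚᵘ (ℚᵘ.mkℚᵘ (ℤ.+ suc n) 0)) (ℚ.toℚᵘ-fromℚᵘ (ℚᵘ.mkℚᵘ (ℤ.+ 1) n)) ⟩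
  ℚᵘ.mkℚᵘ (ℤ.+ suc n) 0 ℚᵘ.* ℚᵘ.mkℚᵘ (ℤ.+ 1) n  ≈⟨ ℚᵘ.*-inverseʳ (ℚᵘ.mkℚᵘ (ℤ.+ suc n) 0) ⟩
  ℚᵘ.1ℚᵘ                                    ∎)
  where open ℚᵘ.≃-Reasoning

fromℕ-cancel : ∀ n {x y} → fromℕ (suc n) * x ≡ fromℕ (suc n) * y → x ≡ y
fromℕ-cancel n {x} {y} eq = begin
  x              ≡⟨ expand x ⟩
  r * (s * x)    ≡⟨ cong (r *_) eq ⟩
  r * (s * y)    ≡⟨ expand y ⟨
  y              ∎
  where
  open ≡-Reasoning
  s r : ℚ
  s = fromℕ (suc n)
  r = ℤ.+ 1 ℚ./ suc n
  expand : ∀ z → z ≡ r * (s * z)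
  expand z = begin
    z              ≡⟨ ℚ.*-identityˡ z ⟨
    1ℚ * z         ≡⟨ cong (_* z) (fromℕ-inverse (suc n)) ⟨
    s * r * z      ≡⟨ solve 3 (λ s r z → s :* r :* z := r :* (s :* z)) refl s r z ⟩
    r * (s * z)    ∎

×-fromℕ : ∀ n x → n ×ℚ x ≡ fromℕ n * x
×-fromℕ zero    x = sym (ℚ.*-zeroˡ x)
×-fromℕ (suc n) x = begin
  x + n ×ℚ x                ≡⟨ cong (x +_) (×-fromℕ n x) ⟩
  x + fromℕ n * x           ≡⟨ solve 2 (λ n x → x :+ n :* x := (con 1ℚ :+ n) :* x) refl (fromℕ n) x ⟩
  (1ℚ + fromℕ n) * x        ≡⟨ cong (_* x) (fromℕ-+ 1 n) ⟨
  fromℕ (suc n) * x         ∎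
  where open ≡-Reasoning

×ˢ-fromℕ : ∀ n a i → (n ×ˢ a) i ≡ fromℕ n * a i
×ˢ-fromℕ n a i = trans (coefficientwise n) (×-fromℕ n (a i))
  where
  coefficientwise : ∀ n → (n ×ˢ a) i ≡ n ×ℚ a i
  coefficientwise zero    = refl
  coefficientwise (suc n) = cong (_+_ (a i)) (coefficientwise n)

×ˢ-cancel : ∀ n {a b} → suc n ×ˢ a Qy.≋ suc n ×ˢ b → a Qy.≋ b
×ˢ-cancel n {a} {b} eq i = fromℕ-cancel n
  (trans (sym (×ˢ-fromℕ (suc n) a i)) (trans (eq i) (×ˢ-fromℕ (suc n) b i)))

∂-coefficient : ∀ a i → ∂ a i ≡ fromℕ (suc i) * a (suc i)
∂-coefficient a i = ×-fromℕ (suc i) (a (suc i))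


-- From the logarithmic equation to the linear relation

module LogarithmicRecurrence
  (p  : ℕ → Qy.Series)
  (p₀ : p 0 Qy.≋ coeff (P 0))
  where

  -- Solved for the logarithm, the equation for V reads log V = (V - 1)/t - y + V - θV + V_y, since
  -- V_x = - t θV. `u` lists the coefficients of the right side; its constant term is P_0 - y + 1 =
  -- 0.
  v u : Qyt.Series
  v zero    = Qy.𝟙
  v (suc n) = p n
  u zero    = Qy.𝟘
  u (suc n) i = p (suc n) i - fromℕ n * p n i + fromℕ (suc i) * p n (suc i)

  defect : ℕ → Qy.Series
  defect n i = fromℕ (suc i) * p (suc n) (suc i) - fromℕ (suc i) * p n (suc i) + fromℕ n * p n i

  p₀-vanishes : ∀ i → p 0 (suc (suc i)) ≡ 0ℚ
  p₀-vanishes i = p₀ (suc (suc i))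

  ∂p₀ : ∀ i → fromℕ (suc i) * p 0 (suc i) ≡ Qy.𝟙 i
  ∂p₀ zero    = trans (ℚ.*-identityˡ (p 0 1)) (p₀ 1)
  ∂p₀ (suc i) = trans (cong (fromℕ (suc (suc i)) *_) (p₀-vanishes i)) (ℚ.*-zeroʳ (fromℕ (suc (suc i))))

  X H : Qyt.Series
  X n i = Qyt.θ u n i - ∂ (u n) i - Qyt.𝟙 n i
  H = d̂ u Qyt.⊞ Qyt.shift X

  H-suc : ∀ n i → H (suc n) i ≡
    fromℕ (suc i) * u (suc n) (suc i) + (fromℕ n * u n i - fromℕ (suc i) * u n (suc i) - Qyt.𝟙 n i)
  H-suc n i = cong₂ _+_ (∂-coefficient (u (suc n)) i)
    (cong₂ (λ x y → x - y - Qyt.𝟙 n i) (×ˢ-fromℕ n (u n) i) (∂-coefficient (u n) i))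

  H-zero : H 0 Qy.≋ Qy.𝟘
  H-zero i = trans (ℚ.+-identityʳ _) (trans (∂-coefficient (u 0) i) (ℚ.*-zeroʳ (fromℕ (suc i))))

  -- Inserting the definition of `u` gives `defect n` plus correction terms built from
  -- `defect (n - 1)` and its derivative, which the hypothesis removes.
  H-defect : ∀ n → (∀ k → k < n → defect k Qy.≋ Qy.𝟘) → H (suc n) Qy.≋ defect n
  H-defect zero _ i = begin
    H 1 i
      ≡⟨ H-suc 0 i ⟩
    s * (p 1 (suc i) - 0ℚ * p 0 (suc i) + fromℕ (suc (suc i)) * p 0 (suc (suc i)))
      + (0ℚ * 0ℚ - s * 0ℚ - Qy.𝟙 i)
      -- At exponent 0 the summand - 1 of `X` supplies the missing - P_0′, because P_0′ = 1; also
      -- P_0″ = 0.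
      ≡⟨ cong₂ (λ x y → s * (p 1 (suc i) - 0ℚ * p 0 (suc i) + fromℕ (suc (suc i)) * x) + (0ℚ * 0ℚ - s * 0ℚ - y))
           (p₀-vanishes i) (sym (∂p₀ i)) ⟩
    s * (p 1 (suc i) - 0ℚ * p 0 (suc i) + fromℕ (suc (suc i)) * 0ℚ)
      + (0ℚ * 0ℚ - s * 0ℚ - s * p 0 (suc i))
      ≡⟨ solve 5 (λ s p₁ p₀ s′ p₀′ → s :* (p₁ :- con 0ℚ :* p₀ :+ s′ :* con 0ℚ)
            :+ (con 0ℚ :* con 0ℚ :- s :* con 0ℚ :- s :* p₀)
            := s :* p₁ :- s :* p₀ :+ con 0ℚ :* p₀′) refl
           s (p 1 (suc i)) (p 0 (suc i)) (fromℕ (suc (suc i))) (p 0 i) ⟩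
    defect 0 i ∎
    where
    open ≡-Reasoning
    s : ℚ
    s = fromℕ (suc i)
  H-defect (suc m) defect≈0 i = begin
    H (suc (suc m)) i
      ≡⟨ H-suc (suc m) i ⟩
    _ ≡⟨ solve 11 (λ m m′ i i′ p₁ p₁′ p₁″ p₀ p₀′ p₀″ p₂ →
           i :* (p₂ :- m′ :* p₁′ :+ i′ :* p₁″)
             :+ (m′ :* (p₁ :- m :* p₀ :+ i :* p₀′) :- i :* (p₁′ :- m :* p₀′ :+ i′ :* p₀″) :- con 0ℚ)
           := i :* p₂ :- i :* p₁′ :+ m′ :* p₁
              :- m′ :* (i :* p₁′ :- i :* p₀′ :+ m :* p₀)
              :+ i :* (i′ :* p₁″ :- i′ :* p₀″ :+ m :* p₀′)) refl
           (fromℕ m) s′ s (fromℕ (suc (suc i)))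
           (p (suc m) i) (p (suc m) (suc i)) (p (suc m) (suc (suc i)))
           (p m i) (p m (suc i)) (p m (suc (suc i)))
           (p (suc (suc m)) (suc i)) ⟩
    defect (suc m) i - s′ * defect m i + s * defect m (suc i)
      ≡⟨ cong₂ (λ x y → defect (suc m) i - s′ * x + s * y)
           (defect≈0 m ℕ.≤-refl i) (defect≈0 m ℕ.≤-refl (suc i)) ⟩
    defect (suc m) i - s′ * 0ℚ + s * 0ℚ
      ≡⟨ solve 3 (λ w s′ s → w :- s′ :* con 0ℚ :+ s :* con 0ℚ := w) refl (defect (suc m) i) s′ s ⟩
    defect (suc m) i ∎
    where
    open ≡-Reasoning
    s s′ : ℚ
    s  = fromℕ (suc i)
    s′ = fromℕ (suc m)

  module _ (θv : Qyt.θ v Qyt.≋ v Qyt.⊛ Qyt.θ u) where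

    d̂v : d̂ v Qyt.≋ v Qyt.⊛ d̂ u
    d̂v = logarithmic-derivative ×ˢ-cancel v u eq₀ θv
      where
      open Derivation Qy.∂-derivation using (d-0; d-1)
      open CommutativeRing Qy.commutativeRing using () renaming (trans to ≋-trans; sym to ≋-sym)
      eq₀ : ∂ Qy.𝟙 Qy.≋ Qy.𝟙 Qy.⊛ ∂ Qy.𝟘
      eq₀ = ≋-trans d-1 (≋-sym (≋-trans (Qy.⊛-identityˡ (∂ Qy.𝟘)) d-0))

    -- To avoid distributing over differences, θU = X + (U_y + 1) is multiplied by V and the product
    -- V X is isolated afterwards.
    v⊛X : ∀ n i → (v Qyt.⊛ X) n i ≡ fromℕ n * v n i - fromℕ (suc i) * v n (suc i) - v n i
    v⊛X n i = begin
      (v Qyt.⊛ X) n i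
        ≡⟨ solve 3 (λ x y z → x := x :+ (y :+ z) :- y :- z) refl _ (∂ (v n) i) (v n i) ⟩
      (v Qyt.⊛ X) n i + (∂ (v n) i + v n i) - ∂ (v n) i - v n i
        ≡⟨ cong (λ x → x - ∂ (v n) i - v n i) split ⟨
      Qyt.θ v n i - ∂ (v n) i - v n i
        ≡⟨ cong₂ (λ x y → x - y - v n i) (×ˢ-fromℕ n (v n) i) (∂-coefficient (v n) i) ⟩
      fromℕ n * v n i - fromℕ (suc i) * v n (suc i) - v n i ∎
      where
      open ≡-Reasoning
      θu-split : Qyt.θ u Qyt.≋ X Qyt.⊞ (d̂ u Qyt.⊞ Qyt.𝟙)
      θu-split n i = solve 3 (λ x y z → x := x :- y :- z :+ (y :+ z)) refl
        (Qyt.θ u n i) (∂ (u n) i) (Qyt.𝟙 n i)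
      split : Qyt.θ v n i ≡ (v Qyt.⊛ X) n i + (∂ (v n) i + v n i)
      split = begin
        Qyt.θ v n i
          ≡⟨ θv n i ⟩
        (v Qyt.⊛ Qyt.θ u) n i
          ≡⟨ Qyt.⊛-cong {v} {v} (λ _ _ → refl) θu-split n i ⟩
        (v Qyt.⊛ (X Qyt.⊞ (d̂ u Qyt.⊞ Qyt.𝟙))) n i
          ≡⟨ Qyt.⊛-distribˡ v X (d̂ u Qyt.⊞ Qyt.𝟙) n i ⟩
        (v Qyt.⊛ X) n i + (v Qyt.⊛ (d̂ u Qyt.⊞ Qyt.𝟙)) n i
          ≡⟨ cong (λ x → (v Qyt.⊛ X) n i + x) (Qyt.⊛-distribˡ v (d̂ u) Qyt.𝟙 n i) ⟩
        (v Qyt.⊛ X) n i + ((v Qyt.⊛ d̂ u) n i + (v Qyt.⊛ Qyt.𝟙) n i)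
          ≡⟨ cong (λ x → (v Qyt.⊛ X) n i + x) (cong₂ _+_ (sym (d̂v n i)) (⊛-identityʳ v n i)) ⟩
        (v Qyt.⊛ X) n i + (∂ (v n) i + v n i) ∎
        where open CommutativeRing Qyt.commutativeRing using () renaming (*-identityʳ to ⊛-identityʳ)

    v⊛H-suc : ∀ n i → (v Qyt.⊛ H) (suc n) i ≡
      fromℕ (suc i) * p n (suc i) + (fromℕ n * v n i - fromℕ (suc i) * v n (suc i) - v n i)
    v⊛H-suc n i = begin
      (v Qyt.⊛ H) (suc n) i
        ≡⟨ Qyt.⊛-distribˡ v (d̂ u) (Qyt.shift X) (suc n) i ⟩
      (v Qyt.⊛ d̂ u) (suc n) i + (v Qyt.⊛ Qyt.shift X) (suc n) i
        ≡⟨ cong₂ _+_ (sym (d̂v (suc n) i)) (Qyt.⊛-shiftʳ v X (suc n) i) ⟩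
      ∂ (p n) i + (v Qyt.⊛ X) n i
        ≡⟨ cong₂ _+_ (∂-coefficient (p n) i) (v⊛X n i) ⟩
      _ ∎
      where open ≡-Reasoning

    -- The coefficient is P_0′ - 1. Its vanishing lets W start one exponent later than H and so
    -- starts the induction.
    v⊛H-one : (v Qyt.⊛ H) 1 Qy.≋ Qy.𝟘
    v⊛H-one i = begin
      (v Qyt.⊛ H) 1 i
        ≡⟨ v⊛H-suc 0 i ⟩
      fromℕ (suc i) * p 0 (suc i) + (0ℚ * Qy.𝟙 i - fromℕ (suc i) * 0ℚ - Qy.𝟙 i)
        ≡⟨ cong (λ x → x + (0ℚ * Qy.𝟙 i - fromℕ (suc i) * 0ℚ - Qy.𝟙 i)) (∂p₀ i) ⟩
      Qy.𝟙 i + (0ℚ * Qy.𝟙 i - fromℕ (suc i) * 0ℚ - Qy.𝟙 i)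
        ≡⟨ solve 2 (λ x s → x :+ (con 0ℚ :* x :- s :* con 0ℚ :- x) := con 0ℚ) refl (Qy.𝟙 i) (fromℕ (suc i)) ⟩
      0ℚ ∎
      where open ≡-Reasoning

    v⊛H-defect : ∀ n → (v Qyt.⊛ H) (suc (suc n)) Qy.≋ defect n
    v⊛H-defect n i = begin
      (v Qyt.⊛ H) (suc (suc n)) i
        ≡⟨ v⊛H-suc (suc n) i ⟩
      s * p (suc n) (suc i) + (fromℕ (suc n) * p n i - s * p n (suc i) - p n i)
        ≡⟨ cong (λ x → s * p (suc n) (suc i) + (x * p n i - s * p n (suc i) - p n i)) (fromℕ-+ 1 n) ⟩
      s * p (suc n) (suc i) + ((1ℚ + fromℕ n) * p n i - s * p n (suc i) - p n i)
        ≡⟨ solve 5 (λ s n p₁ p₀ p₀′ → s :* p₁ :+ ((con 1ℚ :+ n) :* p₀ :- s :* p₀′ :- p₀)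
             := s :* p₁ :- s :* p₀′ :+ n :* p₀) refl s (fromℕ n) (p (suc n) (suc i)) (p n i) (p n (suc i)) ⟩
      defect n i ∎
      where
      open ≡-Reasoning
      s : ℚ
      s = fromℕ (suc i)

    -- One coefficient of V H is evaluated twice, at exponent `n + 1`: as the leading one it is
    -- `defect n`, as a coefficient of W it is the preceding defect, or 0 if there is none.
    defect-vanishes : ∀ n → defect n Qy.≋ Qy.𝟘
    defect-vanishes = <-rec _ go
      where
      open ≡-Reasoning

      go : ∀ n → (∀ {k} → k < n → defect k Qy.≋ Qy.𝟘) → defect n Qy.≋ Qy.𝟘
      go n rec i = begin
        defect n i                   ≡⟨ H-defect n (λ k k<n → rec k<n) i ⟨
        H (suc n) i                  ≡⟨ Qy.⊛-identityˡ (H (suc n)) i ⟨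
        (v 0 Qy.⊛ H (suc n)) i       ≡⟨ Qyt.⊛-leading v H (suc n) H-below i ⟨
        (v Qyt.⊛ H) (suc n) i        ≡⟨ v⊛H n rec i ⟩
        0ℚ                           ∎
        where
        v⊛H : ∀ n → (∀ {k} → k < n → defect k Qy.≋ Qy.𝟘) → (v Qyt.⊛ H) (suc n) Qy.≋ Qy.𝟘
        v⊛H zero    rec   = v⊛H-one
        v⊛H (suc n) rec i = trans (v⊛H-defect n i) (rec ℕ.≤-refl i)

        H-below : ∀ k → k < suc n → H k Qy.≋ Qy.𝟘
        H-below zero    _           = H-zero
        H-below (suc k) (s≤s k<n) i = trans
          (H-defect k (λ l l<k → rec (ℕ.<-trans l<k k<n)) i) (rec k<n i)

-- Polynomials as power series in y

coeff-+ : ∀ p q i → coeff (p +ₚ q) i ≡ coeff p i + coeff q i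
coeff-+ []      q       i       = sym (ℚ.+-identityˡ (coeff q i))
coeff-+ (c ∷ p) []      i       = sym (ℚ.+-identityʳ (coeff (c ∷ p) i))
coeff-+ (c ∷ p) (d ∷ q) zero    = refl
coeff-+ (c ∷ p) (d ∷ q) (suc i) = coeff-+ p q i

coeff-· : ∀ c p i → coeff (c · p) i ≡ c * coeff p i
coeff-· c []      i       = sym (ℚ.*-zeroʳ c)
coeff-· c (x ∷ p) zero    = refl
coeff-· c (x ∷ p) (suc i) = coeff-· c p i

coeff-- : ∀ p q i → coeff (p -ₚ q) i ≡ coeff p i - coeff q i
coeff-- p q i = begin
  coeff (p -ₚ q) i                      ≡⟨ coeff-+ p ((- 1ℚ) · q) i ⟩
  coeff p i + coeff ((- 1ℚ) · q) i      ≡⟨ cong (λ x → coeff p i + x) (coeff-· (- 1ℚ) q i) ⟩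
  coeff p i + (- 1ℚ) * coeff q i        ≡⟨ solve 2 (λ x y → x :+ con (- 1ℚ) :* y := x :- y) refl (coeff p i) (coeff q i) ⟩
  coeff p i - coeff q i                 ∎
  where open ≡-Reasoning

-- `_*ₚ_` and `_⊛_` follow the same recursion on the left factor, so no convolution sum intervenes.
coeff-* : ∀ p q → coeff (p *ₚ q) Qy.≋ coeff p Qy.⊛ coeff q
coeff-* []      q n       = sym (Qy.⊛-zeroˡ (coeff q) n)
coeff-* (c ∷ p) q zero    = begin
  coeff (c · q +ₚ (0ℚ ∷ p *ₚ q)) 0  ≡⟨ coeff-+ (c · q) (0ℚ ∷ p *ₚ q) 0 ⟩
  coeff (c · q) 0 + 0ℚ              ≡⟨ ℚ.+-identityʳ (coeff (c · q) 0) ⟩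
  coeff (c · q) 0                   ≡⟨ coeff-· c q 0 ⟩
  c * coeff q 0                     ∎
  where open ≡-Reasoning
coeff-* (c ∷ p) q (suc n) = trans (coeff-+ (c · q) (0ℚ ∷ p *ₚ q) (suc n))
  (cong₂ _+_ (coeff-· c q (suc n)) (coeff-* p q n))

coeff-′ : ∀ p i → coeff (p ′) i ≡ fromℕ (suc i) * coeff p (suc i)
coeff-′ []      i       = sym (ℚ.*-zeroʳ (fromℕ (suc i)))
coeff-′ (c ∷ p) zero    = begin
  coeff (p +ₚ (0ℚ ∷ p ′)) 0   ≡⟨ coeff-+ p (0ℚ ∷ p ′) 0 ⟩
  coeff p 0 + 0ℚ              ≡⟨ solve 1 (λ x → x :+ con 0ℚ := con 1ℚ :* x) refl (coeff p 0) ⟩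
  1ℚ * coeff p 0              ∎
  where open ≡-Reasoning
coeff-′ (c ∷ p) (suc i) = begin
  coeff (p +ₚ (0ℚ ∷ p ′)) (suc i)                        ≡⟨ coeff-+ p (0ℚ ∷ p ′) (suc i) ⟩
  coeff p (suc i) + coeff (p ′) i                        ≡⟨ cong (λ x → coeff p (suc i) + x) (coeff-′ p i) ⟩
  coeff p (suc i) + fromℕ (suc i) * coeff p (suc i)
    ≡⟨ solve 2 (λ x s → x :+ s :* x := (con 1ℚ :+ s) :* x) refl (coeff p (suc i)) (fromℕ (suc i)) ⟩
  (1ℚ + fromℕ (suc i)) * coeff p (suc i)                 ≡⟨ cong (_* coeff p (suc i)) (fromℕ-+ 1 (suc i)) ⟨
  fromℕ (suc (suc i)) * coeff p (suc i)                  ∎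
  where open ≡-Reasoning

coeff-∑ : ∀ n f i → coeff (∑ n f) i ≡ Qy.sum n (λ j → coeff (f j) i)
coeff-∑ zero    f i = refl
coeff-∑ (suc n) f i = trans (coeff-+ (∑ n f) (f n) i) (cong (_+ coeff (f n) i) (coeff-∑ n f i))

sum-neg : ∀ n (f : ℕ → ℚ) → Qy.sum n (λ j → - f j) ≡ - Qy.sum n f
sum-neg zero    f = refl
sum-neg (suc n) f = trans (cong (_- f n) (sum-neg n f)) (sym (ℚ.neg-distrib-+ (Qy.sum n f) (f n)))

sum-coefficient : ∀ n (f : ℕ → Qy.Series) i → Qyt.sum n f i ≡ Qy.sum n (λ j → f j i)
sum-coefficient zero    f i = refl
sum-coefficient (suc n) f i = cong (_+ f n i) (sum-coefficient n f i)

-- The logarithmic equation for P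

p : ℕ → Qy.Series
p n = coeff (P n)

open LogarithmicRecurrence p (λ _ → refl)

-- j = k - 1 runs over the terms k{(k-1)P_{k-1} - P_k - P'_{k-1}}P_{n-k-1} with n = m + 1.
summand : ℕ → ℕ → Poly
summand m j = fromℕ (suc j) · (fromℕ j · P j -ₚ P (suc j) -ₚ P j ′) *ₚ P (m ∸ suc j)

coeff-inner : ∀ j i → coeff (fromℕ (suc j) · (fromℕ j · P j -ₚ P (suc j) -ₚ P j ′)) i ≡
  fromℕ (suc j) * (fromℕ j * p j i - p (suc j) i - fromℕ (suc i) * p j (suc i))
coeff-inner j i = begin
  coeff (fromℕ (suc j) · (fromℕ j · P j -ₚ P (suc j) -ₚ P j ′)) i
    ≡⟨ coeff-· (fromℕ (suc j)) (fromℕ j · P j -ₚ P (suc j) -ₚ P j ′) i ⟩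
  fromℕ (suc j) * coeff (fromℕ j · P j -ₚ P (suc j) -ₚ P j ′) i
    ≡⟨ cong (fromℕ (suc j) *_) (coeff-- (fromℕ j · P j -ₚ P (suc j)) (P j ′) i) ⟩
  fromℕ (suc j) * (coeff (fromℕ j · P j -ₚ P (suc j)) i - coeff (P j ′) i)
    ≡⟨ cong₂ (λ x y → fromℕ (suc j) * (x - y)) (coeff-- (fromℕ j · P j) (P (suc j)) i) (coeff-′ (P j) i) ⟩
  fromℕ (suc j) * (coeff (fromℕ j · P j) i - p (suc j) i - fromℕ (suc i) * p j (suc i))
    ≡⟨ cong (λ x → fromℕ (suc j) * (x - p (suc j) i - fromℕ (suc i) * p j (suc i))) (coeff-· (fromℕ j) (P j) i) ⟩
  fromℕ (suc j) * (fromℕ j * p j i - p (suc j) i - fromℕ (suc i) * p j (suc i)) ∎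
  where open ≡-Reasoning

P-recurrence : ∀ m i → fromℕ (suc m) * p (suc m) i ≡
  fromℕ (suc m) * (fromℕ (suc m) * p m i - fromℕ (suc i) * p m (suc i)) + Qy.sum m (λ j → coeff (summand m j) i)
P-recurrence m i = begin
  s * p (suc m) i
    ≡⟨ cong (λ q → s * coeff q i) (P-suc m) ⟩
  s * coeff (s · P m -ₚ P m ′ +ₚ r · ∑ m (summand m)) i
    ≡⟨ cong (s *_) (coeff-+ (s · P m -ₚ P m ′) (r · ∑ m (summand m)) i) ⟩
  s * (coeff (s · P m -ₚ P m ′) i + coeff (r · ∑ m (summand m)) i)
    ≡⟨ cong₂ (λ x y → s * (x + y)) (coeff-- (s · P m) (P m ′) i) (coeff-· r (∑ m (summand m)) i) ⟩
  s * (coeff (s · P m) i - coeff (P m ′) i + r * coeff (∑ m (summand m)) i)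
    ≡⟨ cong₂ (λ x y → s * (x - y + r * coeff (∑ m (summand m)) i)) (coeff-· s (P m) i) (coeff-′ (P m) i) ⟩
  s * (s * p m i - fromℕ (suc i) * p m (suc i) + r * coeff (∑ m (summand m)) i)
    ≡⟨ solve 4 (λ s x r y → s :* (x :+ r :* y) := s :* x :+ s :* r :* y) refl s _ r _ ⟩
  s * (s * p m i - fromℕ (suc i) * p m (suc i)) + s * r * coeff (∑ m (summand m)) i
    ≡⟨ cong₂ (λ x y → s * (s * p m i - fromℕ (suc i) * p m (suc i)) + x * y) (fromℕ-inverse (suc m)) (coeff-∑ m (summand m) i) ⟩
  s * (s * p m i - fromℕ (suc i) * p m (suc i)) + 1ℚ * Qy.sum m (λ j → coeff (summand m j) i)
    ≡⟨ cong (λ x → s * (s * p m i - fromℕ (suc i) * p m (suc i)) + x) (ℚ.*-identityˡ _) ⟩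
  s * (s * p m i - fromℕ (suc i) * p m (suc i)) + Qy.sum m (λ j → coeff (summand m j) i) ∎
  where
  open ≡-Reasoning
  s r : ℚ
  s = fromℕ (suc m)
  r = ℤ.+ 1 ℚ./ suc m

⊛-negˡ : ∀ a b n → ((λ i → - a i) Qy.⊛ b) n ≡ - (a Qy.⊛ b) n
⊛-negˡ a b n = sym (-‿distribˡ-* a b n)
  where
  open import Algebra.Properties.Ring (CommutativeRing.ring Qy.commutativeRing) using (-‿distribˡ-*)

-- With k = j + 1, the braces are - u_k, so the left factor is a coefficient of - θU. The bound on
-- `j` excludes the last index of the convolution, where the factor from V is the constant term 1
-- rather than some P.
summand-convolution : ∀ m j → j < m → ∀ i →
  coeff (summand m j) i ≡ - (Qyt.θ u (suc j) Qy.⊛ v (m ∸ j)) i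
summand-convolution m j j<m i = begin
  coeff (summand m j) i
    ≡⟨ coeff-* (fromℕ (suc j) · (fromℕ j · P j -ₚ P (suc j) -ₚ P j ′)) (P (m ∸ suc j)) i ⟩
  (coeff (fromℕ (suc j) · (fromℕ j · P j -ₚ P (suc j) -ₚ P j ′)) Qy.⊛ p (m ∸ suc j)) i
    ≡⟨ Qy.⊛-cong inner (λ l → cong (λ k → v k l) (sym (ℕ.+-∸-assoc 1 j<m))) i ⟩
  ((λ l → - Qyt.θ u (suc j) l) Qy.⊛ v (m ∸ j)) i
    ≡⟨ ⊛-negˡ (Qyt.θ u (suc j)) (v (m ∸ j)) i ⟩
  - (Qyt.θ u (suc j) Qy.⊛ v (m ∸ j)) i ∎
  where
  open ≡-Reasoning
  inner : ∀ l → coeff (fromℕ (suc j) · (fromℕ j · P j -ₚ P (suc j) -ₚ P j ′)) l ≡ - Qyt.θ u (suc j) l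
  inner l = begin
    coeff (fromℕ (suc j) · (fromℕ j · P j -ₚ P (suc j) -ₚ P j ′)) l
      ≡⟨ coeff-inner j l ⟩
    fromℕ (suc j) * (fromℕ j * p j l - p (suc j) l - fromℕ (suc l) * p j (suc l))
      ≡⟨ solve 4 (λ s a b c → s :* (a :- b :- c) := :- (s :* (b :- a :+ c))) refl (fromℕ (suc j)) _ (p (suc j) l) _ ⟩
    - (fromℕ (suc j) * u (suc j) l)
      ≡⟨ cong -_ (×ˢ-fromℕ (suc j) (u (suc j)) l) ⟨
    - Qyt.θ u (suc j) l ∎

-- The recurrence contains every term of the convolution but the last, `(m + 1) u_{m+1}`; that term
-- contains P_{m+1}, which the recurrence itself eliminates.
P-θv : Qyt.θ v Qyt.≋ v Qyt.⊛ Qyt.θ u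
P-θv zero    i = sym (Qyt.⊛-vanishesʳ v (Qyt.θ u) 0 (λ { zero z≤n i → refl }) i)
P-θv (suc m) i = begin
  Qyt.θ v (suc m) i
    ≡⟨ ×ˢ-fromℕ (suc m) (v (suc m)) i ⟩
  s * p m i
    -- Expanded so that the first bracket is the right side of the recurrence and can be folded into
    -- `s * p (suc m) i`.
    ≡⟨ solve 4 (λ s x n y → s :* x := (s :* (s :* x :- y) :+ n) :- n :- s :* ((s :- con 1ℚ) :* x :- y)) refl
         s (p m i) (- Σ) (fromℕ (suc i) * p m (suc i)) ⟩
  (s * (s * p m i - fromℕ (suc i) * p m (suc i)) + - Σ) - (- Σ)
    - s * ((s - 1ℚ) * p m i - fromℕ (suc i) * p m (suc i))
    ≡⟨ cong₂ (λ x y → x - (- Σ) - s * (y * p m i - fromℕ (suc i) * p m (suc i))) (sym recurrence) s-1 ⟩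
  s * p (suc m) i - (- Σ) - s * (fromℕ m * p m i - fromℕ (suc i) * p m (suc i))
    ≡⟨ solve 5 (λ s x n y z → s :* x :- (:- n) :- s :* (y :- z) := n :+ s :* (x :- y :+ z)) refl
         s (p (suc m) i) Σ _ _ ⟩
  Σ + s * u (suc m) i
    ≡⟨ cong (λ x → Σ + x) (sym last) ⟩
  Σ + (Qyt.θ u (suc m) Qy.⊛ v (m ∸ m)) i
    ≡⟨ sum-coefficient (suc m) (λ j → Qyt.θ u (suc j) Qy.⊛ v (m ∸ j)) i ⟨
  Qyt.sum (suc m) (λ j → Qyt.θ u (suc j) Qy.⊛ v (m ∸ j)) i
    ≡⟨ Qyt.⊛-convolution (Qyt.tail (Qyt.θ u)) v m i ⟨
  (Qyt.tail (Qyt.θ u) Qyt.⊛ v) m i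
    ≡⟨ ℚ.+-identityˡ _ ⟨
  0ℚ + (Qyt.tail (Qyt.θ u) Qyt.⊛ v) m i
    ≡⟨ cong (λ x → x + (Qyt.tail (Qyt.θ u) Qyt.⊛ v) m i) (Qy.⊛-zeroˡ (v (suc m)) i) ⟨
  (Qyt.θ u Qyt.⊛ v) (suc m) i
    ≡⟨ Qyt.⊛-comm (Qyt.θ u) v (suc m) i ⟩
  (v Qyt.⊛ Qyt.θ u) (suc m) i ∎
  where
  open ≡-Reasoning
  s Σ : ℚ
  s = fromℕ (suc m)
  Σ = Qy.sum m (λ j → (Qyt.θ u (suc j) Qy.⊛ v (m ∸ j)) i)

  s-1 : s - 1ℚ ≡ fromℕ m
  s-1 = trans (cong (_- 1ℚ) (fromℕ-+ 1 m)) (solve 1 (λ m → con 1ℚ :+ m :- con 1ℚ := m) refl (fromℕ m))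

  recurrence : s * p (suc m) i ≡ s * (s * p m i - fromℕ (suc i) * p m (suc i)) + - Σ
  recurrence = trans (P-recurrence m i)
    (cong (λ x → s * (s * p m i - fromℕ (suc i) * p m (suc i)) + x)
      (trans (Qy.sum-cong m (λ j j<m → summand-convolution m j j<m i)) (sum-neg m _)))

  last : (Qyt.θ u (suc m) Qy.⊛ v (m ∸ m)) i ≡ s * u (suc m) i
  last = begin
    (Qyt.θ u (suc m) Qy.⊛ v (m ∸ m)) i  ≡⟨ cong (λ k → (Qyt.θ u (suc m) Qy.⊛ v k) i) (ℕ.n∸n≡0 m) ⟩
    (Qyt.θ u (suc m) Qy.⊛ Qy.𝟙) i       ≡⟨ Qy.⊛-comm (Qyt.θ u (suc m)) Qy.𝟙 i ⟩
    (Qy.𝟙 Qy.⊛ Qyt.θ u (suc m)) i       ≡⟨ Qy.⊛-identityˡ (Qyt.θ u (suc m)) i ⟩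
    Qyt.θ u (suc m) i                   ≡⟨ ×ˢ-fromℕ (suc m) (u (suc m)) i ⟩
    s * u (suc m) i                     ∎

-- Coefficientwise form of P_{n+1}′ = P_n′ − n P_n.
P-differential : ∀ n i → fromℕ (suc i) * p (suc n) (suc i) ≡ fromℕ (suc i) * p n (suc i) - fromℕ n * p n i
P-differential n i = begin
  x                       ≡⟨ solve 3 (λ x y z → x := (x :- y :+ z) :+ (y :- z)) refl x y z ⟩
  (x - y + z) + (y - z)   ≡⟨ cong (λ e → e + (y - z)) (defect-vanishes P-θv n i) ⟩
  0ℚ + (y - z)            ≡⟨ ℚ.+-identityˡ _ ⟩
  y - z                   ∎
  where
  open ≡-Reasoning
  x y z : ℚ
  x = fromℕ (suc i) * p (suc n) (suc i)
  y = fromℕ (suc i) * p n (suc i)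
  z = fromℕ n * p n i

-- Integrating `n P_n` raises the degree by at most one. P_0 already has degree 1, so the count
-- starts at P_1, whose derivative is P_0′ because the factor n is then 0.
P-degree : ∀ n i → suc n < i → p (suc n) i ≡ 0ℚ
P-degree zero    (suc (suc i)) _ = fromℕ-cancel (suc i) (begin
  s * p 1 (suc (suc i))              ≡⟨ P-differential 0 (suc i) ⟩
  s * 0ℚ - 0ℚ * p 0 (suc i)          ≡⟨ solve 2 (λ s x → s :* con 0ℚ :- con 0ℚ :* x := s :* con 0ℚ) refl s (p 0 (suc i)) ⟩
  s * 0ℚ                             ∎)
  where
  open ≡-Reasoning
  s : ℚ
  s = fromℕ (suc (suc i))
P-degree zero    (suc zero) (s≤s ())
P-degree (suc n) (suc i) (s≤s n<i) = fromℕ-cancel i (begin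
  s * p (suc (suc n)) (suc i)
    ≡⟨ P-differential (suc n) i ⟩
  s * p (suc n) (suc i) - fromℕ (suc n) * p (suc n) i
    ≡⟨ cong₂ (λ x y → s * x - fromℕ (suc n) * y) (P-degree n (suc i) (ℕ.m<n⇒m<1+n n<i)) (P-degree n i n<i) ⟩
  s * 0ℚ - fromℕ (suc n) * 0ℚ
    ≡⟨ solve 2 (λ s x → s :* con 0ℚ :- x :* con 0ℚ := s :* con 0ℚ) refl s (fromℕ (suc n)) ⟩
  s * 0ℚ ∎)
  where
  open ≡-Reasoning
  s : ℚ
  s = fromℕ (suc i)

-- The numbers a_{n,k}, A_n and B_n

fromℕ-nonZero : ∀ n .{{_ : ℕ.NonZero n}} → ℚ.NonZero (fromℕ n)
fromℕ-nonZero n = ℚ.pos⇒nonZero (fromℕ n) {{ℚ.normalize-pos n 1}}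

[-1]^-square : ∀ n → [-1]^ n * [-1]^ n ≡ 1ℚ
[-1]^-square zero    = refl
[-1]^-square (suc n) = trans
  (solve 1 (λ e → :- e :* :- e := e :* e) refl ([-1]^ n)) ([-1]^-square n)

coeff-y^-same : ∀ m → coeff (y^ m) m ≡ 1ℚ
coeff-y^-same zero    = refl
coeff-y^-same (suc m) = coeff-y^-same m

coeff-y^-other : ∀ m i → m ≢ i → coeff (y^ m) i ≡ 0ℚ
coeff-y^-other zero    zero    m≢i = contradiction refl m≢i
coeff-y^-other zero    (suc i) m≢i = refl
coeff-y^-other (suc m) zero    m≢i = refl
coeff-y^-other (suc m) (suc i) m≢i = coeff-y^-other m i (λ m≡i → m≢i (cong suc m≡i))

sum-zero : ∀ n {f : ℕ → ℚ} → (∀ j → j < n → f j ≡ 0ℚ) → Qy.sum n f ≡ 0ℚ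
sum-zero zero    f≡0 = refl
sum-zero (suc n) f≡0 = cong₂ _+_ (sum-zero n (λ j j<n → f≡0 j (ℕ.m<n⇒m<1+n j<n))) (f≡0 n ℕ.≤-refl)

sum-single : ∀ n {f : ℕ → ℚ} k → k < n → (∀ j → j < n → j ≢ k → f j ≡ 0ℚ) → Qy.sum n f ≡ f k
sum-single (suc n) {f} k k<1+n f≡0 with k ℕ.≟ n
... | yes refl = trans
  (cong (_+ f n) (sum-zero n (λ j j<n → f≡0 j (ℕ.m<n⇒m<1+n j<n) (ℕ.<⇒≢ j<n)))) (ℚ.+-identityˡ (f n))
... | no k≢n = trans
  (cong₂ _+_ (sum-single n k (ℕ.≤∧≢⇒< (ℕ.s≤s⁻¹ k<1+n) k≢n) (λ j j<n → f≡0 j (ℕ.m<n⇒m<1+n j<n)))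
             (f≡0 n ℕ.≤-refl (λ n≡k → k≢n (sym n≡k))))
  (ℚ.+-identityʳ (f k))

sum-scale : ∀ n (c : ℚ) f → c * Qy.sum n f ≡ Qy.sum n (λ j → c * f j)
sum-scale zero    c f = ℚ.*-zeroʳ c
sum-scale (suc n) c f = trans (ℚ.*-distribˡ-+ c (Qy.sum n f) (f n)) (cong (_+ c * f n) (sum-scale n c f))

coeff-expansion : ∀ n c i → coeff (expansion n c) i ≡
  [-1]^ (suc n) * 1/ n ! * Qy.sum (suc n) (λ k → [-1]^ k * c k * coeff (y^ (n ∸ k)) i)
coeff-expansion n c i = trans
  (coeff-· ([-1]^ (suc n) * 1/ n !) (∑ (suc n) (λ k → ([-1]^ k * c k) · y^ (n ∸ k))) i)
  (cong ([-1]^ (suc n) * 1/ n ! *_) (trans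
    (coeff-∑ (suc n) (λ k → ([-1]^ k * c k) · y^ (n ∸ k)) i)
    (Qy.sum-cong (suc n) (λ k _ → coeff-· ([-1]^ k * c k) (y^ (n ∸ k)) i))))

coeff-expansion-≤ : ∀ n c i → i ≤ n → coeff (expansion n c) i ≡
  [-1]^ (suc n) * 1/ n ! * ([-1]^ (n ∸ i) * c (n ∸ i))
coeff-expansion-≤ n c i i≤n = begin
  coeff (expansion n c) i
    ≡⟨ coeff-expansion n c i ⟩
  [-1]^ (suc n) * 1/ n ! * Qy.sum (suc n) (λ k → [-1]^ k * c k * coeff (y^ (n ∸ k)) i)
    ≡⟨ cong ([-1]^ (suc n) * 1/ n ! *_) (sum-single (suc n) (n ∸ i) (s≤s (ℕ.m∸n≤m n i)) other) ⟩
  [-1]^ (suc n) * 1/ n ! * ([-1]^ (n ∸ i) * c (n ∸ i) * coeff (y^ (n ∸ (n ∸ i))) i)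
    ≡⟨ cong (λ x → [-1]^ (suc n) * 1/ n ! * ([-1]^ (n ∸ i) * c (n ∸ i) * x)) same ⟩
  [-1]^ (suc n) * 1/ n ! * ([-1]^ (n ∸ i) * c (n ∸ i) * 1ℚ)
    ≡⟨ cong ([-1]^ (suc n) * 1/ n ! *_) (ℚ.*-identityʳ _) ⟩
  [-1]^ (suc n) * 1/ n ! * ([-1]^ (n ∸ i) * c (n ∸ i)) ∎
  where
  open ≡-Reasoning
  other : ∀ k → k < suc n → k ≢ n ∸ i → [-1]^ k * c k * coeff (y^ (n ∸ k)) i ≡ 0ℚ
  other k k≤n k≢n∸i = trans
    (cong ([-1]^ k * c k *_) (coeff-y^-other (n ∸ k) i
      (λ n∸k≡i → k≢n∸i (trans (sym (ℕ.m∸[m∸n]≡n (ℕ.s≤s⁻¹ k≤n))) (cong (n ∸_) n∸k≡i)))))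
    (ℚ.*-zeroʳ ([-1]^ k * c k))
  same : coeff (y^ (n ∸ (n ∸ i))) i ≡ 1ℚ
  same = trans (cong (λ m → coeff (y^ m) i) (ℕ.m∸[m∸n]≡n i≤n)) (coeff-y^-same i)

coeff-expansion-> : ∀ n c i → n < i → coeff (expansion n c) i ≡ 0ℚ
coeff-expansion-> n c i n<i = begin
  coeff (expansion n c) i
    ≡⟨ coeff-expansion n c i ⟩
  [-1]^ (suc n) * 1/ n ! * Qy.sum (suc n) (λ k → [-1]^ k * c k * coeff (y^ (n ∸ k)) i)
    ≡⟨ cong ([-1]^ (suc n) * 1/ n ! *_) (sum-zero (suc n) (λ k _ → trans
         (cong ([-1]^ k * c k *_) (coeff-y^-other (n ∸ k) i (ℕ.<⇒≢ (ℕ.≤-<-trans (ℕ.m∸n≤m n k) n<i))))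
         (ℚ.*-zeroʳ ([-1]^ k * c k)))) ⟩
  [-1]^ (suc n) * 1/ n ! * 0ℚ
    ≡⟨ ℚ.*-zeroʳ ([-1]^ (suc n) * 1/ n !) ⟩
  0ℚ ∎
  where open ≡-Reasoning

-- Up to exponent `n` signs and factorials cancel against those in `a[ n ,_]`; beyond it the claim
-- is the degree bound.
P-expansion : ∀ n → 1 ≤ n → P n ≈ₚ expansion n (a[ n ,_])
P-expansion n@(suc m) _ i with i ℕ.≤? n
... | no i≰n = trans (P-degree m i (ℕ.≰⇒> i≰n)) (sym (coeff-expansion-> n (a[ n ,_]) i (ℕ.≰⇒> i≰n)))
... | yes i≤n = sym (begin
  coeff (expansion n (a[ n ,_])) i
    ≡⟨ coeff-expansion-≤ n (a[ n ,_]) i i≤n ⟩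
  e * r * (g * (e * f * g * p n (n ∸ (n ∸ i))))
    ≡⟨ solve 5 (λ e r g f x → e :* r :* (g :* (e :* f :* g :* x)) := (e :* e) :* (g :* g) :* (f :* r) :* x) refl
         e r g f (p n (n ∸ (n ∸ i))) ⟩
  (e * e) * (g * g) * (f * r) * p n (n ∸ (n ∸ i))
    ≡⟨ cong₂ (λ x y → x * y * (f * r) * p n (n ∸ (n ∸ i))) ([-1]^-square (suc n)) ([-1]^-square (n ∸ i)) ⟩
  1ℚ * 1ℚ * (f * r) * p n (n ∸ (n ∸ i))
    ≡⟨ cong₂ (λ x k → 1ℚ * 1ℚ * x * p n k) (fromℕ-inverse (n !) {{n ℕ.!≢0}}) (ℕ.m∸[m∸n]≡n i≤n) ⟩
  1ℚ * 1ℚ * 1ℚ * p n i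
    ≡⟨ ℚ.*-identityˡ (p n i) ⟩
  p n i ∎)
  where
  open ≡-Reasoning
  e r g f : ℚ
  e = [-1]^ (suc n)
  r = 1/ n !
  g = [-1]^ (n ∸ i)
  f = fromℕ (n !)

α β : ℕ → ℚ
α n = - (fromℕ (n !) * p n 0)
β n = fromℕ (n !) * p n 1

a[n,n]≡α : ∀ n → a[ n , n ] ≡ α n
a[n,n]≡α n = begin
  - e * f * e * p n (n ∸ n)   ≡⟨ cong (λ k → - e * f * e * p n k) (ℕ.n∸n≡0 n) ⟩
  - e * f * e * p n 0         ≡⟨ solve 3 (λ e f x → :- e :* f :* e :* x := e :* e :* :- (f :* x)) refl e f (p n 0) ⟩
  e * e * α n                 ≡⟨ cong (_* α n) ([-1]^-square n) ⟩
  1ℚ * α n                    ≡⟨ ℚ.*-identityˡ (α n) ⟩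
  α n                         ∎
  where
  open ≡-Reasoning
  e f : ℚ
  e = [-1]^ n
  f = fromℕ (n !)

-- Encodes a_{n,-1} = 0, which truncated subtraction would confuse with a_{n,0}.
a[_,_-1] : ℕ → ℕ → ℚ
a[ n , zero  -1] = 0ℚ
a[ n , suc k -1] = a[ n , k ]

-- Makes the triangle recurrence uniform in `k`: for `k = 0` the coefficient named lies just above
-- the degree, so it is 0.
a-predecessor : ∀ m k → k ≤ suc m →
  a[ suc m , k -1] ≡ [-1]^ (suc (suc m)) * fromℕ (suc m !) * - [-1]^ k * p (suc m) (suc (suc m ∸ k))
a-predecessor m zero    _   = sym (trans
  (cong ([-1]^ (suc (suc m)) * fromℕ (suc m !) * - [-1]^ 0 *_) (P-degree m (suc (suc m)) ℕ.≤-refl))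
  (ℚ.*-zeroʳ ([-1]^ (suc (suc m)) * fromℕ (suc m !) * - [-1]^ 0)))
a-predecessor m (suc k) k<m = cong₂ (λ x j → [-1]^ (suc (suc m)) * fromℕ (suc m !) * x * p (suc m) j)
  (sym (solve 1 (λ x → :- (:- x) := x) refl ([-1]^ k))) (ℕ.+-∸-assoc 1 k<m)

-- The linear relation at y^(m-k). The divisor is the exponent brought down by differentiating
-- y^(m+1-k).
a-recurrence : ∀ m k → 1 ≤ m → k ≤ m → .{{_ : ℚ.NonZero (fromℕ (suc m ∸ k))}} →
  a[ suc m , k ] ≡ fromℕ (suc m) * a[ m , k -1] + fromℕ (suc m) * fromℕ m ℚ.÷ fromℕ (suc m ∸ k) * a[ m , k ]
a-recurrence m@(suc m′) k _ k≤m = fromℕ-cancel i (begin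
  q * (e * fromℕ (suc m !) * g * p (suc m) (suc m ∸ k))
    ≡⟨ cong₂ (λ x j → q * (e * x * g * p (suc m) j)) (fromℕ-* (suc m) (m !)) [1+m]∸k ⟩
  q * (- (- e′) * (s * f) * g * p (suc m) (suc i))
    ≡⟨ solve 6 (λ q e s f g x → q :* (:- (:- e) :* (s :* f) :* g :* x) := e :* s :* f :* g :* (q :* x)) refl
         q e′ s f g (p (suc m) (suc i)) ⟩
  e′ * s * f * g * (q * p (suc m) (suc i))
    ≡⟨ cong (e′ * s * f * g *_) (P-differential m i) ⟩
  e′ * s * f * g * (q * p m (suc i) - fromℕ m * p m i)
    ≡⟨ solve 8 (λ q e s f g m x y → e :* s :* f :* g :* (q :* x :- m :* y)
                 := q :* (s :* (:- e :* f :* :- g :* x)) :+ con 1ℚ :* (s :* m :* (:- e :* f :* g :* y))) refl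
         q e′ s f g (fromℕ m) (p m (suc i)) (p m i) ⟩
  q * (s * (- e′ * f * - g * p m (suc i))) + 1ℚ * (s * fromℕ m * a[ m , k ])
    ≡⟨ cong₂ (λ x y → q * (s * x) + y * (s * fromℕ m * a[ m , k ]))
         (sym (a-predecessor m′ k k≤m))
         (sym (trans (cong (_* ℚ.1/ fromℕ (suc m ∸ k)) (cong fromℕ (sym [1+m]∸k)))
                     (ℚ.*-inverseʳ (fromℕ (suc m ∸ k))))) ⟩
  q * (s * a[ m , k -1]) + q * (ℚ.1/ fromℕ (suc m ∸ k)) * (s * fromℕ m * a[ m , k ])
    ≡⟨ solve 5 (λ q x r y z → q :* x :+ q :* r :* (y :* z) := q :* (x :+ y :* r :* z)) refl
         q (s * a[ m , k -1]) (ℚ.1/ fromℕ (suc m ∸ k)) (s * fromℕ m) a[ m , k ] ⟩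
  q * (s * a[ m , k -1] + s * fromℕ m ℚ.÷ fromℕ (suc m ∸ k) * a[ m , k ]) ∎)
  where
  open ≡-Reasoning
  i : ℕ
  i = m ∸ k
  [1+m]∸k : suc m ∸ k ≡ suc i
  [1+m]∸k = ℕ.+-∸-assoc 1 k≤m
  q e e′ s f g : ℚ
  q = fromℕ (suc i)
  e = [-1]^ (suc (suc m))
  e′ = [-1]^ m
  s = fromℕ (suc m)
  f = fromℕ (m !)
  g = [-1]^ k

β-recurrence : ∀ m → β (suc m) ≡ fromℕ (suc m) * β m + fromℕ (suc m) * fromℕ m * α m
β-recurrence m = begin
  fromℕ (suc m !) * p (suc m) 1
    ≡⟨ cong (_* p (suc m) 1) (fromℕ-* (suc m) (m !)) ⟩
  s * f * p (suc m) 1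
    ≡⟨ solve 3 (λ s f x → s :* f :* x := s :* f :* (con 1ℚ :* x)) refl s f (p (suc m) 1) ⟩
  s * f * (1ℚ * p (suc m) 1)
    ≡⟨ cong (s * f *_) (P-differential m 0) ⟩
  s * f * (1ℚ * p m 1 - fromℕ m * p m 0)
    ≡⟨ solve 5 (λ s f m x y → s :* f :* (con 1ℚ :* x :- m :* y) := s :* (f :* x) :+ s :* m :* :- (f :* y)) refl
         s f (fromℕ m) (p m 1) (p m 0) ⟩
  s * β m + s * fromℕ m * α m ∎
  where
  open ≡-Reasoning
  s f : ℚ
  s = fromℕ (suc m)
  f = fromℕ (m !)

C-factorials : ∀ n k → k ≤ n → fromℕ (n C k) * (fromℕ (k !) * fromℕ ((n ∸ k) !)) ≡ fromℕ (n !)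
C-factorials n k k≤n = begin
  fromℕ (n C k) * (fromℕ (k !) * fromℕ ((n ∸ k) !))  ≡⟨ cong (fromℕ (n C k) *_) (fromℕ-* (k !) ((n ∸ k) !)) ⟨
  fromℕ (n C k) * fromℕ (k ! ℕ.* (n ∸ k) !)          ≡⟨ fromℕ-* (n C k) (k ! ℕ.* (n ∸ k) !) ⟨
  fromℕ ((n C k) ℕ.* (k ! ℕ.* (n ∸ k) !))             ≡⟨ cong fromℕ nCk*k![n∸k]!≡n! ⟩
  fromℕ (n !)                                        ∎
  where
  open ≡-Reasoning
  instance k![n∸k]!≢0 = k ℕ.!* (n ∸ k) !≢0
  nCk*k![n∸k]!≡n! : (n C k) ℕ.* (k ! ℕ.* (n ∸ k) !) ≡ n !
  nCk*k![n∸k]!≡n! = trans (cong (ℕ._* (k ! ℕ.* (n ∸ k) !)) (nCk≡n!/k![n-k]! k≤n)) (ℕ.m/n*n≡m (k![n∸k]!∣n! k≤n))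

-- The summand for A_n with n = i + 2 and k = j + 1, so that n - k - 1 = i - j.
A-term : ℕ → ℕ → ℚ
A-term i j = fromℕ (i C j) *
  (fromℕ (suc j) * fromℕ j * α j - α (suc j) + fromℕ (suc j) * β j) * α (i ∸ j)

-- The braces contribute the factor `j !`, the remaining `α` contributes `(i ∸ j) !`, and the
-- binomial coefficient turns their product into `i !`, independent of `j`. This is why a binomial
-- appears in the recurrence for A.
A-term-summand : ∀ i j → j ≤ i → A-term i j ≡ fromℕ (i !) * coeff (summand (suc i) j) 0
A-term-summand i j j≤i = begin
  c * (s * fromℕ j * α j - α (suc j) + s * β j) * α (i ∸ j)
    ≡⟨ cong (λ x → c * (s * fromℕ j * α j - - (x * p (suc j) 0) + s * β j) * α (i ∸ j)) (fromℕ-* (suc j) (j !)) ⟩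
  c * (s * fromℕ j * - (f * p j 0) - - (s * f * p (suc j) 0) + s * (f * p j 1)) * - (h * p (i ∸ j) 0)
    ≡⟨ solve 9 (λ c s j f h x x₁ y z →
           c :* (s :* j :* :- (f :* x) :- :- (s :* f :* x₁) :+ s :* (f :* y)) :* :- (h :* z)
           := c :* (f :* h) :* (s :* (j :* x :- x₁ :- con 1ℚ :* y) :* z)) refl
         c s (fromℕ j) f h (p j 0) (p (suc j) 0) (p j 1) (p (i ∸ j) 0) ⟩
  c * (f * h) * (s * (fromℕ j * p j 0 - p (suc j) 0 - 1ℚ * p j 1) * p (i ∸ j) 0)
    ≡⟨ cong₂ (λ x y → x * (y * p (i ∸ j) 0)) (C-factorials i j j≤i) (sym (coeff-inner j 0)) ⟩
  fromℕ (i !) * (coeff (fromℕ (suc j) · (fromℕ j · P j -ₚ P (suc j) -ₚ P j ′)) 0 * p (i ∸ j) 0)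
    ≡⟨ cong (fromℕ (i !) *_) (coeff-* (fromℕ (suc j) · (fromℕ j · P j -ₚ P (suc j) -ₚ P j ′)) (P (i ∸ j)) 0) ⟨
  fromℕ (i !) * coeff (summand (suc i) j) 0 ∎
  where
  open ≡-Reasoning
  c s f h : ℚ
  c = fromℕ (i C j)
  s = fromℕ (suc j)
  f = fromℕ (j !)
  h = fromℕ ((i ∸ j) !)

-- Scaling by n! and cancelling the 1/n leaves (n-1)! before the sum, of which the terms absorb
-- (n-2)!; hence the factor n - 1.
α-recurrence : ∀ i → let m = suc i in α (suc m) ≡
  fromℕ (suc m) * fromℕ (suc m) * α m + fromℕ (suc m) * β m - fromℕ m * Qy.sum m (A-term i)
α-recurrence i = begin
  - (fromℕ (suc m !) * p (suc m) 0)
    ≡⟨ cong (λ x → - (x * p (suc m) 0)) (fromℕ-* (suc m) (m !)) ⟩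
  - (s * f * p (suc m) 0)
    ≡⟨ solve 3 (λ s f x → :- (s :* f :* x) := :- (f :* (s :* x))) refl s f (p (suc m) 0) ⟩
  - (f * (s * p (suc m) 0))
    ≡⟨ cong (λ x → - (f * x)) (P-recurrence m 0) ⟩
  - (f * (s * (s * p m 0 - 1ℚ * p m 1) + Σ))
    ≡⟨ solve 5 (λ s f x y z → :- (f :* (s :* (s :* x :- con 1ℚ :* y) :+ z))
                 := s :* s :* :- (f :* x) :+ s :* (f :* y) :- f :* z) refl s f (p m 0) (p m 1) Σ ⟩
  s * s * α m + s * β m - f * Σ
    ≡⟨ cong (λ x → s * s * α m + s * β m - x) f*Σ ⟩
  s * s * α m + s * β m - fromℕ m * Qy.sum m (A-term i) ∎
  where
  open ≡-Reasoning
  m : ℕ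
  m = suc i
  s f Σ : ℚ
  s = fromℕ (suc m)
  f = fromℕ (m !)
  Σ = Qy.sum m (λ j → coeff (summand m j) 0)
  f*Σ : f * Σ ≡ fromℕ m * Qy.sum m (A-term i)
  f*Σ = begin
    f * Σ                                                        ≡⟨ cong (_* Σ) (fromℕ-* m (i !)) ⟩
    fromℕ m * fromℕ (i !) * Σ                                    ≡⟨ ℚ.*-assoc (fromℕ m) (fromℕ (i !)) Σ ⟩
    fromℕ m * (fromℕ (i !) * Σ)                                  ≡⟨ cong (fromℕ m *_) (sum-scale m (fromℕ (i !)) _) ⟩
    fromℕ m * Qy.sum m (λ j → fromℕ (i !) * coeff (summand m j) 0)
      ≡⟨ cong (fromℕ m *_) (Qy.sum-cong m (λ j j<m → sym (A-term-summand i j (ℕ.s≤s⁻¹ j<m)))) ⟩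
    fromℕ m * Qy.sum m (A-term i) ∎

-- Correctness and cost of the procedure

update-same : ∀ {K X : Set} (_≟_ : DecidableEquality K) (T : K → X) k x → update _≟_ T k x k ≡ x
update-same _≟_ T k x = cong (if_then x else T k) (dec-true (k ≟ k) refl)

update-other : ∀ {K X : Set} (_≟_ : DecidableEquality K) (T : K → X) k x l → l ≢ k → update _≟_ T k x l ≡ T l
update-other _≟_ T k x l l≢k = cong (if_then x else T l) (dec-false (l ≟ k) l≢k)

≤1+n-elim : ∀ {l n} (Q : ℕ → Set) → (∀ l → l ≤ n → Q l) → Q (suc n) → l ≤ suc n → Q l
≤1+n-elim {l} {n} Q below top l≤1+n with ℕ.m≤n⇒m<n∨m≡n l≤1+n
... | inj₁ (s≤s l≤n) = below l l≤n
... | inj₂ refl      = top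

update-≤ : ∀ {X : Set} {T : ℕ → X} {n x} (Q : ℕ → X → Set) →
  (∀ l → l ≤ n → Q l (T l)) → Q (suc n) x → ∀ l → l ≤ suc n → Q l ((T [ suc n ↦ x ]) l)
update-≤ {T = T} {n} {x} Q old new l = ≤1+n-elim (λ l → Q l ((T [ suc n ↦ x ]) l))
  (λ l l≤n → subst (Q l) (sym (update-other ℕ._≟_ T (suc n) x l (ℕ.<⇒≢ (s≤s l≤n)))) (old l l≤n))
  (subst (Q (suc n)) (sym (update-same ℕ._≟_ T (suc n) x)) new)

-- A program logic for results and costs

Computes : ∀ {X : Set} → Prog ℚ X → (X → Set) → ℕ → Set
Computes q Q T = ∃[ x ] ∃[ t ] Runs q x t × t ≤ T × Q x

runs->>= : ∀ {X Y : Set} {q : Prog ℚ X} {f : X → Prog ℚ Y} {x y s t} →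
  Runs q x s → Runs (f x) y t → Runs (q >>= f) y (s ℕ.+ t)
runs->>= done r = r
runs->>= {f = f} {y = y} {t = t} (step {e = e} {κ = κ} {v = v} {t = t′} e⇓v r′) r =
  subst (Runs (calc-then e (λ v → κ v >>= f)) y) (sym (ℕ.+-assoc (operations e) t′ t)) (step e⇓v (runs->>= r′ r))

computes-return : ∀ {X : Set} {x : X} {Q} → Q x → Computes (return x) Q 0
computes-return Qx = _ , 0 , done , z≤n , Qx

computes->>= : ∀ {X Y : Set} {q : Prog ℚ X} {f : X → Prog ℚ Y} {Q Q′ s t} →
  Computes q Q s → (∀ x → Q x → Computes (f x) Q′ t) → Computes (q >>= f) Q′ (s ℕ.+ t)
computes->>= (x , _ , r , s≤ , Qx) h with h x Qx
... | y , _ , r′ , t≤ , Qy = y , _ , runs->>= r r′ , ℕ.+-mono-≤ s≤ t≤ , Qy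

computes-calc : ∀ {X : Set} {e v} {κ : ℚ → Prog ℚ X} {Q t} →
  e ⇓ v → Computes (κ v) Q t → Computes (calc-then e κ) Q (operations e ℕ.+ t)
computes-calc {e = e} e⇓v (x , _ , r , t≤ , Qx) = x , _ , step e⇓v r , ℕ.+-monoʳ-≤ (operations e) t≤ , Qx

computes-≤ : ∀ {X : Set} {q : Prog ℚ X} {Q s t} → s ≤ t → Computes q Q s → Computes q Q t
computes-≤ s≤t (x , _ , r , ≤s , Qx) = x , _ , r , ℕ.≤-trans ≤s s≤t , Qx

computes-⊆ : ∀ {X : Set} {q : Prog ℚ X} {Q Q′ t} → (∀ x → Q x → Q′ x) → Computes q Q t → Computes q Q′ t
computes-⊆ Q⊆Q′ (x , _ , r , t≤ , Qx) = x , _ , r , t≤ , Q⊆Q′ x Qx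

-- The budget `t` is the same for every round; nested loops of varying length are first widened to
-- length `N` by `computes-≤`.
computes-for : ∀ {S : Set} m {s : S} {f : ℕ → S → Prog ℚ S} (I : ℕ → S → Set) {t} →
  I 0 s → (∀ i → i < m → ∀ s → I i s → Computes (f i s) (I (suc i)) t) →
  Computes (for m s f) (I m) (m ℕ.* t)
computes-for zero    I start body = computes-return start
computes-for (suc m) I {t} start body = subst (Computes _ _) (ℕ.+-comm (m ℕ.* t) t)
  (computes->>= (computes-for m I start (λ i i<m → body i (ℕ.m<n⇒m<1+n i<m)))
                (body m ℕ.≤-refl))

open Procedure 0ℚ 1ℚ using (integers; binomials; sequences; triangle)

Integers : ℕ → (ℕ → ℚ) → Set
Integers N ι = ∀ l → l ≤ N → ι l ≡ fromℕ l

computes-integers : ∀ N → Computes (integers N) (Integers N) (N ℕ.* 1)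
computes-integers N = computes-for N Integers (λ { zero z≤n → refl }) λ i _ ι ι≡ →
  computes-calc (add val val) (computes-return
    (update-≤ (λ l x → x ≡ fromℕ l) ι≡
      (trans (cong (_+ 1ℚ) (ι≡ i ℕ.≤-refl)) (trans (ℚ.+-comm (fromℕ i) 1ℚ) (sym (fromℕ-+ 1 i))))))

-- All `k` are covered, including `k > m`: the last entry of the next row is computed from the zero
-- just right of this one.
Binomials : ℕ → (ℕ → ℕ → ℚ) → Set
Binomials N T = ∀ m → m ≤ N → ∀ k → T m k ≡ fromℕ (m C k)

computes-binomials : ∀ N → Computes (binomials N) (Binomials N) (N ℕ.* (N ℕ.* 1))
computes-binomials N = computes-for N Binomials first λ m m<N T T≡ →
  computes-≤ (ℕ.≤-trans (ℕ.≤-reflexive (ℕ.+-identityʳ _)) (ℕ.*-monoˡ-≤ 1 m<N)) (computes->>=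
    (computes-for (suc m) (Row m) (Row-zero m) λ k _ row row≡ →
      computes-calc (add val val) (computes-return (Row-suc m k row T T≡ row≡)))
    λ row row≡ → computes-return (update-≤ {T = T} {x = row} (λ m row → ∀ k → row k ≡ fromℕ (m C k)) T≡ (complete m row row≡)))
  where
  first : Binomials 0 _
  first zero z≤n zero    = refl
  first zero z≤n (suc k) = refl

  Row : ℕ → ℕ → (ℕ → ℚ) → Set
  Row m k row = (∀ l → l ≤ k → row l ≡ fromℕ (suc m C l)) × (∀ l → k < l → row l ≡ 0ℚ)

  Row-zero : ∀ m → Row m 0 ((λ _ → 0ℚ) [ 0 ↦ 1ℚ ])
  Row-zero m = (λ { zero z≤n → refl }) , (λ { (suc l) _ → refl })

  Row-suc : ∀ m k row T → Binomials m T → Row m k row → Row m (suc k) (row [ suc k ↦ T m k + T m (suc k) ])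
  Row-suc m k row T T≡ (low , high) =
    update-≤ (λ l x → x ≡ fromℕ (suc m C l)) low (begin
      T m k + T m (suc k)                       ≡⟨ cong₂ _+_ (T≡ m ℕ.≤-refl k) (T≡ m ℕ.≤-refl (suc k)) ⟩
      fromℕ (m C k) + fromℕ (m C suc k)         ≡⟨ fromℕ-+ (m C k) (m C suc k) ⟨
      fromℕ ((m C k) ℕ.+ (m C suc k))           ≡⟨ cong fromℕ (nCk+nC[k+1]≡[n+1]C[k+1] m k) ⟩
      fromℕ (suc m C suc k)                     ∎)
    , λ l 1+k<l → trans (update-other ℕ._≟_ row (suc k) _ l (ℕ.>⇒≢ 1+k<l)) (high l (ℕ.<⇒≤ 1+k<l))
    where open ≡-Reasoning

  complete : ∀ m row → Row m (suc m) row → ∀ k → row k ≡ fromℕ (suc m C k)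
  complete m row (low , high) k with k ℕ.≤? suc m
  ... | yes k≤1+m = low k k≤1+m
  ... | no  k≰1+m = trans (high k (ℕ.≰⇒> k≰1+m)) (cong fromℕ (sym (k>n⇒nCk≡0 (ℕ.≰⇒> k≰1+m))))

Sequences : ℕ → (ℕ → ℚ) × (ℕ → ℚ) → Set
Sequences n (A , B) = ∀ l → l ≤ n → A l ≡ α l × B l ≡ β l

1+[N∸1] : ∀ {N} → 1 ≤ N → suc (N ∸ 1) ≡ N
1+[N∸1] = ℕ.m+[n∸m]≡n

2+i≤N : ∀ {N i} → i < N ∸ 1 → suc (suc i) ≤ N
2+i≤N {suc N} i<N = s≤s i<N

-- Each round spends 4 operations on B_n, 8 on each of at most `N` summands and 6 on the final
-- expression for A_n.
computes-sequences : ∀ N ι T → 1 ≤ N → Integers N ι → Binomials N T →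
  Computes (sequences N ι T (1ℚ + 1ℚ)) (Sequences N) ((N ∸ 1) ℕ.* (4 ℕ.+ (N ℕ.* 8 ℕ.+ 6)))
computes-sequences N ι T 1≤N ι≡ T≡ = computes-⊆ (λ s → subst (λ n → Sequences n s) (1+[N∸1] 1≤N))
  (computes-for (N ∸ 1) (λ i → Sequences (suc i))
    (λ { zero _ → refl , refl ; (suc zero) _ → refl , refl ; (suc (suc l)) (s≤s ()) })
    λ i i<N∸1 (A , B) AB≡ →
      let n   = suc (suc i)
          n≤N = 2+i≤N i<N∸1
          A≡  = λ l l≤ → proj₁ (AB≡ l l≤)
          B≡  = λ l l≤ → proj₂ (AB≡ l l≤)
          ιn  = ι≡ n n≤N
          ιm  = ι≡ (suc i) (ℕ.<⇒≤ n≤N)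
          Am  = A≡ (suc i) ℕ.≤-refl
          Bm  = B≡ (suc i) ℕ.≤-refl
      in computes-calc (add (mul val val) (mul (mul val val) val))
        (computes-≤ (ℕ.+-monoˡ-≤ 6 (ℕ.*-monoˡ-≤ 8 (ℕ.<⇒≤ n≤N)))
          (computes->>=
            (computes-for (suc i) (λ j s → s ≡ Qy.sum j (A-term i)) refl λ j j<1+i s s≡ →
              let j≤i = ℕ.s≤s⁻¹ j<1+i
                  j≤N = ℕ.≤-trans j<1+i (ℕ.<⇒≤ n≤N)
              in computes-calc
                   (add val (mul (mul val (add (sub (mul (mul val val) val) val) (mul val val))) val))
                   (computes-return (cong₂ _+_ s≡ (cong₂ _*_
                     (cong₂ _*_ (T≡ i (ℕ.<⇒≤ (ℕ.<⇒≤ n≤N)) j)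
                       (cong₂ _+_
                         (cong₂ _-_
                           (cong₂ _*_ (cong₂ _*_ (ι≡ (suc j) j≤N) (ι≡ j (ℕ.<⇒≤ j≤N))) (A≡ j (ℕ.<⇒≤ j<1+i)))
                           (A≡ (suc j) j<1+i))
                         (cong₂ _*_ (ι≡ (suc j) j≤N) (B≡ j (ℕ.<⇒≤ j<1+i)))))
                     -- The index `n ∸ k ∸ 1` reduces to `suc i ∸ j ∸ 1`, which is `i ∸ j` only
                     -- after using `j ≤ i`.
                     (trans (cong A (cong ℕ.pred (ℕ.+-∸-assoc 1 j≤i)))
                       (A≡ (i ∸ j) (ℕ.≤-trans (ℕ.m∸n≤m i j) (ℕ.n≤1+n i))))))))
            λ s s≡ → computes-calc (sub (add (mul (mul val val) val) (mul val val)) (mul val val))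
              (computes-return λ l l≤n →
                update-≤ (λ l x → x ≡ α l) A≡
                  (trans (cong₂ _-_ (cong₂ _+_ (cong₂ _*_ (cong₂ _*_ ιn ιn) Am) (cong₂ _*_ ιn Bm))
                                    (cong₂ _*_ ιm s≡))
                         (sym (α-recurrence i))) l l≤n
                , update-≤ (λ l x → x ≡ β l) B≡
                  (trans (cong₂ _+_ (cong₂ _*_ ιn Bm) (cong₂ _*_ (cong₂ _*_ ιn ιm) Am))
                         (sym (β-recurrence (suc i)))) l l≤n))))

-- Column -1 is the only negative one that the next row reads, at `k = 0`.
record TriangleRow (n : ℕ) (row : ℤ → ℚ) : Set where
  field
    left    : row -[1+ 0 ] ≡ 0ℚ
    entries : ∀ k → k ≤ n → row (ℤ.+ k) ≡ a[ n , k ]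

-- Row 0 is left out because its prescribed entry in column -1 is 1, against the field `left`.
Triangle : ℕ → (ℕ → ℤ → ℚ) → Set
Triangle N a = ∀ n → n ≤ N → 1 ≤ n → TriangleRow n (a n)

open TriangleRow

row-predecessor : ∀ {n row} → TriangleRow n row → ∀ k → k ≤ suc n → row (ℤ.+ k ℤ.- ℤ.+ 1) ≡ a[ n , k -1]
row-predecessor r zero    _         = left r
row-predecessor r (suc k) (s≤s k≤n) = entries r k k≤n

-- The entry in column `n` is stored before the loop fills the columns from 0 upwards, so it is
-- tracked apart from them.
record PartialRow (n k : ℕ) (row : ℤ → ℚ) : Set where
  field
    left    : row -[1+ 0 ] ≡ 0ℚ
    last    : row (ℤ.+ n) ≡ a[ n , n ]
    entries : ∀ l → l < k → l < n → row (ℤ.+ l) ≡ a[ n , l ]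

PartialRow-suc : ∀ {n k row x} → k < n → x ≡ a[ n , k ] → PartialRow n k row →
  PartialRow n (suc k) (row [ ℤ.+ k ↦ x ]ᶻ)
PartialRow-suc {n} {k} {row} {x} k<n x≡ r = record
  { left    = R.left
  ; last    = trans (update-other ℤ._≟_ row (ℤ.+ k) x (ℤ.+ n) (λ n≡k → ℕ.>⇒≢ k<n (ℤ.+-injective n≡k))) R.last
  ; entries = λ l l<1+k l<n → entry l (ℕ.m≤n⇒m<n∨m≡n (ℕ.s≤s⁻¹ l<1+k)) l<n
  }
  where
  module R = PartialRow r
  entry : ∀ l → _ → l < n → (row [ ℤ.+ k ↦ x ]ᶻ) (ℤ.+ l) ≡ a[ n , l ]
  entry l (inj₂ refl) l<n = trans (update-same ℤ._≟_ row (ℤ.+ k) x) x≡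
  entry l (inj₁ l<k)  l<n = trans
    (update-other ℤ._≟_ row (ℤ.+ k) x (ℤ.+ l) (λ l≡k → ℕ.<⇒≢ l<k (ℤ.+-injective l≡k))) (R.entries l l<k l<n)

÷-cong : ∀ {x x′ y y′} (x≡ : x ≡ x′) (y≡ : y ≡ y′) .{{_ : ℚ.NonZero y}} .{{_ : ℚ.NonZero y′}} →
  x ℚ.÷ y ≡ x′ ℚ.÷ y′
÷-cong refl refl = refl

computes-triangle : ∀ N ι A → 1 ≤ N → Integers N ι → (∀ l → l ≤ N → A l ≡ α l) →
  Computes (triangle N ι (1ℚ + 1ℚ) A) (Triangle N) ((N ∸ 1) ℕ.* (N ℕ.* 5))
computes-triangle N ι A 1≤N ι≡ A≡ = computes-⊆ (λ a → subst (λ n → Triangle n a) (1+[N∸1] 1≤N))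
  (computes-for (N ∸ 1) (λ i → Triangle (suc i)) first λ i i<N∸1 a a≡ →
    let n   = suc (suc i)
        n≤N = 2+i≤N i<N∸1
        prev = a≡ (suc i) ℕ.≤-refl (s≤s z≤n)
    in computes-≤ (ℕ.≤-trans (ℕ.≤-reflexive (ℕ.+-identityʳ _)) (ℕ.*-monoˡ-≤ 5 n≤N)) (computes->>=
      (computes-for n (PartialRow n)
        (record
          { left    = refl
          ; last    = trans (update-same ℤ._≟_ (λ _ → 0ℚ) (ℤ.+ n) (A n)) (trans (A≡ n n≤N) (sym (a[n,n]≡α n)))
          ; entries = λ _ ()
          })
        λ k k<n row row≡ →
          let k≤m = ℕ.s≤s⁻¹ k<n
              ι[n∸k] = ι≡ (n ∸ k) (ℕ.≤-trans (ℕ.m∸n≤m n k) n≤N)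
              n∸k≢0 = fromℕ-nonZero (n ∸ k) {{ℕ.>-nonZero (ℕ.m<n⇒0<n∸m k<n)}}
              -- `div` needs the stored value to be nonzero, `a-recurrence` the number it
              -- represents; `k < n` gives both.
              ι[n∸k]≢0 = subst ℚ.NonZero (sym ι[n∸k]) n∸k≢0
          in computes-calc
               (add (mul val val) (mul (div {{ι[n∸k]≢0}} (mul val val) val) val))
               (computes-return (PartialRow-suc k<n
                 (trans
                   (cong₂ _+_
                     (cong₂ _*_ (ι≡ n n≤N) (row-predecessor prev k (ℕ.<⇒≤ k<n)))
                     (cong₂ _*_
                       (÷-cong (cong₂ _*_ (ι≡ n n≤N) (ι≡ (suc i) (ℕ.<⇒≤ n≤N))) ι[n∸k] {{ι[n∸k]≢0}} {{n∸k≢0}})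
                       (entries prev k k≤m)))
                   (sym (a-recurrence (suc i) k (s≤s z≤n) k≤m {{n∸k≢0}})))
                 row≡)))
      λ row row≡ → computes-return
        (update-≤ (λ l row → 1 ≤ l → TriangleRow l row) a≡ (λ _ → complete row≡))))
  where
  first : Triangle 1 _
  first 1 _ _ = record
    { left    = refl
    ; entries = λ { zero _ → refl ; (suc zero) _ → refl ; (suc (suc _)) (s≤s ()) }
    }
  first (suc (suc _)) (s≤s ()) _

  complete : ∀ {n row} → PartialRow n n row → TriangleRow n row
  complete {n} {row} r = record { left = R.left ; entries = λ k k≤n → entry k (ℕ.m≤n⇒m<n∨m≡n k≤n) }
    where
    module R = PartialRow r
    entry : ∀ k → _ → row (ℤ.+ k) ≡ a[ n , k ]
    entry k (inj₁ k<n)  = R.entries k k<n k<n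
    entry k (inj₂ refl) = R.last

computes-procedure : ∀ N → 1 ≤ N → Computes (procedure 0ℚ 1ℚ N) (Triangle N) (cost N)
computes-procedure N 1≤N =
  computes-calc (add val val)
    (computes->>= (computes-integers N) λ ι ι≡ →
      computes->>= (computes-binomials N) λ T T≡ →
        computes->>= (computes-sequences N ι T 1≤N ι≡ T≡) λ (A , B) AB≡ →
          computes-triangle N ι A 1≤N ι≡ (λ l l≤N → proj₁ (AB≡ l l≤N)))

theorem4p11 : ∃[ c ] ∀ N → 1 ≤ N →
    ∃[ a ] ∃[ t ]
    Runs (procedure 0ℚ 1ℚ N) a t
    × t ≤ c ℕ.* N ^ 2
    × (∀ n → 1 ≤ n → n ≤ N →
    P n ≈ₚ expansion n (a[ n ,_])
    × (∀ k → k ≤ n → a n (ℤ.+ k) ≡ a[ n , k ]))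
theorem4p11 = 26 , λ N 1≤N →
  let a , t , runs , t≤ , rows = computes-procedure N 1≤N
  in a , t , runs , ℕ.≤-trans t≤ (cost-bound N 1≤N) ,
     λ n 1≤n n≤N → P-expansion n 1≤n , entries (rows n n≤N 1≤n)
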